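{- Let $K\subset L$ be a field extension and let $A$ be an $n$-dimensional $K$-subspace of $L$. Assume that there exists an $n$-dimensional $K$-subspace $B$ of $L$ with $1\notin B$ such that $A$ is not matched to $B$. Then $B\oplus K$ contains a subspace whose 1-atom is a nontrivial intermediate field $K\subsetneq M\subset L$.
   Context: For $n$-dimensional $K$-subspaces $A,B$ of $L$, an ordered basis $\{a_1,\ldots,a_n\}$ of $A$ is matched to an ordered basis $\{b_1,\ldots,b_n\}$ of $B$ if $a_i^{ -1}A\cap B\subset\langle b_1,\ldots,b_{i-1},b_{i+1},\ldots,b_n\rangle$ for each $i$ (angle brackets denote $K$-span); $A$ is matched to $B$ if every ordered basis of $A$ can be matched to some ordered basis of $B$. For $K$-subspaces $X,Y$ of $L$, $\langle XY\rangle$ is the $K$-span of $\{xy: x\in X,y\in Y\}$. For a $K$-subspace $W$ of $L$ and a nonzero finite-dimensional $K$-subspace $X$, set $\partial_W(X)=\dim_K\langle XW\rangle-\dim_K X$. Let $\psi$ be the set of nonzero finite-dimensional $K$-subspaces $X$ of $L$ with $\langle XW\rangle\neq L$; if $\psi\ne\emptyset$, the 1st-connectivity is $\kappa(W)=\min_{X\in\psi}\partial_W(X)$. A 1st-fragment of $W$ is an $X\in\psi$ with $\partial_W(X)=\kappa(W)$, and a 1-atom of $W$ is a 1st-fragment of minimum dimension. -}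

module Defs where

open import Level using (Level; suc; _⊔_)
open import Algebra.Bundles using (CommutativeRing)
import Algebra.Definitions as AlgebraDefinitions
import Algebra.Properties.CommutativeMonoid.Sum as Summation
open import Data.Fin.Base using (Fin)
open import Data.Integer.Base as ℤ using (ℤ; _⊖_)
open import Data.Nat.Base as ℕ using (ℕ)
open import Data.Product.Base using (∃; ∃-syntax; _×_)
open import Data.Vec.Functional using (Vector)
open import Relation.Binary.PropositionalEquality.Core using (_≡_; _≢_)
open import Relation.Nullary.Negation.Core using (¬_)
open import Relation.Unary using (Pred; _∈_; _⊆_; _∩_; Universal)

record Field (c ℓ : Level) : Set (suc (c ⊔ ℓ)) where
  field
    commutativeRing : CommutativeRing c ℓ
  open CommutativeRing commutativeRing public
  open AlgebraDefinitions _≈_ using (Invertible)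
  field
    1≉0           : ¬ (1# ≈ 0#)
    ≉0⇒invertible : ∀ x → ¬ (x ≈ 0#) → Invertible 1# _*_ x

module _ {c ℓ : Level} (L : Field c ℓ) where
  open Field L

  Subset : Set (suc (c ⊔ ℓ))
  Subset = Pred Carrier (c ⊔ ℓ)

  record IsSubfield (K : Subset) : Set (c ⊔ ℓ) where
    field
      resp      : ∀ {x y} → x ≈ y → x ∈ K → y ∈ K
      0∈        : 0# ∈ K
      1∈        : 1# ∈ K
      +-closed  : ∀ {x y} → x ∈ K → y ∈ K → (x + y) ∈ K
      -‿closed  : ∀ {x} → x ∈ K → (- x) ∈ K
      *-closed  : ∀ {x y} → x ∈ K → y ∈ K → (x * y) ∈ K
      ⁻¹-closed : ∀ {x y} → x ∈ K → x * y ≈ 1# → y ∈ K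

-- Linear algebra inside L over a subfield K.  All subsets are predicates, so
-- closure under the setoid equality of L is part of being a subspace.
module Extension {c ℓ : Level} (L : Field c ℓ) (K : Subset L) where
  open Field L
  open Summation +-commutativeMonoid using (sum)

  record IsSubspace (X : Subset L) : Set (c ⊔ ℓ) where
    field
      resp     : ∀ {x y} → x ≈ y → x ∈ X → y ∈ X
      0∈       : 0# ∈ X
      +-closed : ∀ {x y} → x ∈ X → y ∈ X → (x + y) ∈ X
      ·-closed : ∀ {k x} → k ∈ K → x ∈ X → (k * x) ∈ X

  combination : ∀ {n} → Vector Carrier n → Vector Carrier n → Carrier
  combination k v = sum (λ i → k i * v i)

  Span : ∀ {s} → Pred Carrier s → Pred Carrier (c ⊔ ℓ ⊔ s)
  Span S x = ∃[ n ] ∃ λ (k : Vector Carrier n) → ∃ λ (v : Vector Carrier n) →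
    (∀ i → k i ∈ K) × (∀ i → v i ∈ S) × x ≈ combination k v

  LinearlyIndependent : ∀ {n} → Vector Carrier n → Set (c ⊔ ℓ)
  LinearlyIndependent {n} v = ∀ (k : Vector Carrier n) → (∀ i → k i ∈ K) →
    combination k v ≈ 0# → ∀ i → k i ≈ 0#

  Range : ∀ {n} → Vector Carrier n → Pred Carrier ℓ
  Range v x = ∃[ i ] x ≈ v i

  -- An ordered basis of X.
  record IsBasis (X : Subset L) {n : ℕ} (v : Vector Carrier n) : Set (c ⊔ ℓ) where
    field
      members     : ∀ i → v i ∈ X
      independent : LinearlyIndependent v
      spanning    : X ⊆ Span (Range v)

  HasDimension : Subset L → ℕ → Set (c ⊔ ℓ)
  HasDimension X n = ∃ λ (v : Vector Carrier n) → IsBasis X v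

  infix 8 _⁻¹·_

  -- a⁻¹X, for nonzero a.
  _⁻¹·_ : Carrier → Subset L → Subset L
  (a ⁻¹· X) y = ∃[ a⁻¹ ] ∃[ x ] a⁻¹ * a ≈ 1# × x ∈ X × y ≈ a⁻¹ * x

  RangeExcept : ∀ {n} → Vector Carrier n → Fin n → Pred Carrier ℓ
  RangeExcept v i x = ∃[ j ] j ≢ i × x ≈ v j

  BasisMatched : Subset L → Subset L → ∀ {n} → Vector Carrier n → Vector Carrier n → Set (c ⊔ ℓ)
  BasisMatched A B a b = ∀ i → (a i ⁻¹· A) ∩ B ⊆ Span (RangeExcept b i)

  -- Used for subspaces A and B of the same dimension n.
  Matched : ℕ → Subset L → Subset L → Set (c ⊔ ℓ)
  Matched n A B = ∀ (a : Vector Carrier n) → IsBasis A a →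
    ∃ λ (b : Vector Carrier n) → IsBasis B b × BasisMatched A B a b

  infixl 6 _⊞_

  _⊞_ : Subset L → Subset L → Subset L
  (X ⊞ Y) z = ∃[ x ] ∃[ y ] x ∈ X × y ∈ Y × z ≈ x + y

  Products : Subset L → Subset L → Subset L
  Products X Y z = ∃[ x ] ∃[ y ] x ∈ X × y ∈ Y × z ≈ x * y

  ⟨_·_⟩ : Subset L → Subset L → Subset L
  ⟨ X · Y ⟩ = Span (Products X Y)

  -- ∂ W X d says that ⟨XW⟩ and X are finite-dimensional and that
  -- dim ⟨XW⟩ - dim X = d in ℤ.
  ∂ : Subset L → Subset L → ℤ → Set (c ⊔ ℓ)
  ∂ W X d = ∃[ m ] ∃[ n ] HasDimension ⟨ X · W ⟩ m × HasDimension X n × d ≡ m ⊖ n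

  record ψ (W X : Subset L) : Set (c ⊔ ℓ) where
    field
      isSubspace        : IsSubspace X
      nonzero           : ∃[ x ] x ∈ X × ¬ (x ≈ 0#)
      finiteDimensional : ∃[ n ] HasDimension X n
      product≢L         : ¬ Universal ⟨ X · W ⟩

  -- κ(W) = k: the value k is attained on ψ and is a lower bound there.
  IsConnectivity : Subset L → ℤ → Set (suc (c ⊔ ℓ))
  IsConnectivity W k =
    (∃[ X ] ψ W X × ∂ W X k) × (∀ X → ψ W X → ∀ d → ∂ W X d → k ℤ.≤ d)

  IsFragment : Subset L → Subset L → Set (suc (c ⊔ ℓ))
  IsFragment W X = ψ W X × ∃[ k ] IsConnectivity W k × ∂ W X k

  IsAtom : Subset L → Subset L → Set (suc (c ⊔ ℓ))
  IsAtom W X = IsFragment W X ×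
    (∀ Y → IsFragment W Y → ∀ m n → HasDimension X m → HasDimension Y n → m ℕ.≤ n)

-- By the linear form of Rado's theorem, a basis a of A with no matched basis of B
-- has an index set J with dim T + |J| > n, where T is the set of b ∈ B with
-- aⱼ b ∈ A for all j ∈ J.  Put W = T ⊕ K and S = {x ∈ A : xT ⊆ A}.  Then SW ⊆ A
-- and dim S + dim W ≥ n + 2.  Dyson's e-transform keeps these properties and stops
-- at a pair with SW ⊆ S; as dim S ≤ n, still dim W ≥ 2.  Now κ(W) = 0, and the
-- fragments are the W-stable subspaces.  Translate one of least dimension so that
-- it contains 1 and call it M: for 0 ≠ x ∈ M the stable subspace M ∩ xM is nonzero,
-- so M = xM, which makes M a field.  It contains W, hence is larger than K, and
-- it is not L, since dim M ≤ n while B is n-dimensional and omits 1.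

module Submission where

open import Defs
open import Level using (Level; suc; _⊔_; Lift; lift; lower)
open import Axiom.ExcludedMiddle using (ExcludedMiddle)
open import Data.Fin.Base as Fin using (Fin; zero; punchIn; punchOut)
import Data.Fin.Properties as Fin
open import Data.Fin.Subset as FS using (∣_∣; inside; outside)
import Data.Fin.Subset.Properties as FS
import Data.Integer.Base as ℤ
import Data.Integer.Properties as ℤ
open import Data.List.Base as List using (List)
open import Data.List.Membership.Propositional.Properties using (∈-allFin)
open import Data.List.Relation.Unary.All as All using (All)
open import Data.Nat.Base as ℕ using (ℕ; zero; z≤n; s≤s)
import Data.Nat.Properties as ℕ
open import Data.Nat.Tactic.RingSolver using (solve-∀)
open import Data.Product.Base using (∃; ∃-syntax; _×_; _,_; proj₁; proj₂)
open import Data.Sum.Base using (_⊎_; inj₁; inj₂)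
open import Data.Unit.Base using (⊤; tt)
import Data.Vec.Base as Vec
open import Data.Vec.Functional using (Vector; []; _∷_; tail; insertAt; updateAt)
open import Data.Vec.Functional.Properties
  using (insertAt-lookup; insertAt-punchIn; updateAt-updates; updateAt-minimal)
open import Function.Base using (_∘_; id; const)
open import Relation.Binary.PropositionalEquality.Core as ≡ using (_≡_; _≢_)
import Relation.Binary.Reasoning.Setoid as SetoidReasoning
open import Relation.Nullary.Decidable using (Dec; yes; no; map′; decidable-stable)
open import Relation.Nullary.Negation.Core using (¬_; contradiction)
open import Relation.Unary using (Pred; _∈_; _∉_; _⊆_; _⊂_; _∩_; _≐_; U; Universal)

-- Let Vᵢ be aᵢ⁻¹A ∩ B. A basis b of B is matched to a exactly when, for each i, the functional dual
-- to bᵢ vanishes on Vᵢ. So a match is an independent system of functionals on B, the i-th taken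
-- from the annihilator of Vᵢ, and Rado's theorem says when such a transversal exists. Its rank
-- condition, read back in B, bounds the dimension of every intersection of the Vᵢ. No dual space is
-- built: a functional is represented by its kernel, and the Vᵢ are enlarged inside B to hyperplanes
-- without losing the condition.
--
-- If the condition fails at J, then aⱼT ⊆ A for j in J, so S contains the independent vectors aⱼ
-- and dim S is at least |J|. Hence dim S + dim T exceeds n, and since 1 is outside B, adjoining it
-- to T gains one more: this is the 2 in n + 2. The surplus leaves W one dimension more than K has,
-- which is what keeps the resulting field from being K.

-- Cardinalities of finite index sets

∣p∪q∣+∣p∩q∣≡∣p∣+∣q∣ : ∀ {n} (p q : FS.Subset n) → ∣ p FS.∪ q ∣ ℕ.+ ∣ p FS.∩ q ∣ ≡ ∣ p ∣ ℕ.+ ∣ q ∣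
∣p∪q∣+∣p∩q∣≡∣p∣+∣q∣ Vec.[] Vec.[] = ≡.refl
∣p∪q∣+∣p∩q∣≡∣p∣+∣q∣ (outside Vec.∷ p) (outside Vec.∷ q) = ∣p∪q∣+∣p∩q∣≡∣p∣+∣q∣ p q
∣p∪q∣+∣p∩q∣≡∣p∣+∣q∣ (outside Vec.∷ p) (inside  Vec.∷ q) =
  ≡.trans (≡.cong ℕ.suc (∣p∪q∣+∣p∩q∣≡∣p∣+∣q∣ p q)) (≡.sym (ℕ.+-suc ∣ p ∣ ∣ q ∣))
∣p∪q∣+∣p∩q∣≡∣p∣+∣q∣ (inside  Vec.∷ p) (outside Vec.∷ q) = ≡.cong ℕ.suc (∣p∪q∣+∣p∩q∣≡∣p∣+∣q∣ p q)
∣p∪q∣+∣p∩q∣≡∣p∣+∣q∣ (inside  Vec.∷ p) (inside  Vec.∷ q) = ≡.cong ℕ.suc (≡.trans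
  (ℕ.+-suc ∣ p FS.∪ q ∣ ∣ p FS.∩ q ∣)
  (≡.trans (≡.cong ℕ.suc (∣p∪q∣+∣p∩q∣≡∣p∣+∣q∣ p q)) (≡.sym (ℕ.+-suc ∣ p ∣ ∣ q ∣))))

∣p∣≤1+∣p-i∣ : ∀ {n} (p : FS.Subset n) i → ∣ p ∣ ℕ.≤ ℕ.suc ∣ p FS.- i ∣
∣p∣≤1+∣p-i∣ (outside Vec.∷ p) zero = ℕ.m≤n⇒m≤1+n (ℕ.≤-reflexive (≡.cong ∣_∣ (≡.sym (FS.p─⊥≡p p))))
∣p∣≤1+∣p-i∣ (inside  Vec.∷ p) zero = ℕ.≤-reflexive (≡.cong (ℕ.suc ∘ ∣_∣) (≡.sym (FS.p─⊥≡p p)))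
∣p∣≤1+∣p-i∣ (outside Vec.∷ p) (Fin.suc i) = ∣p∣≤1+∣p-i∣ p i
∣p∣≤1+∣p-i∣ (inside  Vec.∷ p) (Fin.suc i) = s≤s (∣p∣≤1+∣p-i∣ p i)

j∈p-i⇒j≢i : ∀ {n} (p : FS.Subset n) {i j} → j FS.∈ p FS.- i → j ≢ i
j∈p-i⇒j≢i (x Vec.∷ p) {zero}    {zero}    () ≡.refl
j∈p-i⇒j≢i (x Vec.∷ p) {Fin.suc i} {Fin.suc j} (Vec.there j∈) ≡.refl = j∈p-i⇒j≢i p j∈ ≡.refl

-- Scalars and subspaces

module LinearAlgebra {c ℓ : Level} (em : ExcludedMiddle (suc (c ⊔ ℓ)))
  (L : Field c ℓ) (K : Subset L) (K-subfield : IsSubfield L K) where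

  open Field L hiding (zero)
  open Extension L K
  open import Algebra.Properties.Semiring.Sum semiring
    using (sum; sum-cong-≋; sum-replicate-zero; ∑-distrib-+; sum-remove; *-distribˡ-sum; *-distribʳ-sum)
  open import Algebra.Properties.Ring ring using (-1*x≈-x; -‿distribˡ-*)
  open import Algebra.Solver.Ring.NaturalCoefficients.Default commutativeSemiring
    using (solve; _:=_; _:+_; _:*_)
  module ≈-Reasoning = SetoidReasoning setoid
  module K = IsSubfield K-subfield

  -- Excluded middle is assumed one level up because the descent to a minimal stable subspace asks
  -- whether a smaller subspace exists. Questions about elements are lifted to that level.
  dec : {P : Set (c ⊔ ℓ)} → Dec P
  dec {P} = map′ lower lift (em {Lift (suc (c ⊔ ℓ)) P})

  dec≈ : ∀ x y → Dec (x ≈ y)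
  dec≈ x y = map′ lower lift (em {Lift (suc (c ⊔ ℓ)) (x ≈ y)})

  inverse : ∀ {x} → ¬ x ≈ 0# → ∃[ y ] y * x ≈ 1#
  inverse {x} x≉0 with ≉0⇒invertible x x≉0
  ... | y , yx≈1 , _ = y , yx≈1

  inverse∈K : ∀ {k} → k ∈ K → ¬ k ≈ 0# → ∃[ l ] l ∈ K × l * k ≈ 1#
  inverse∈K k∈K k≉0 with inverse k≉0
  ... | l , lk≈1 = l , K.⁻¹-closed k∈K (trans (*-comm _ _) lk≈1) , lk≈1

  cancel-inverse : ∀ {y x} z → y * x ≈ 1# → y * (x * z) ≈ z
  cancel-inverse z yx≈1 = trans (sym (*-assoc _ _ z)) (trans (*-congʳ yx≈1) (*-identityˡ z))

  module Subspace {X : Subset L} (isSubspace : IsSubspace X) where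
    open IsSubspace isSubspace public

    -‿closed : ∀ {x} → x ∈ X → - x ∈ X
    -‿closed x∈X = resp (-1*x≈-x _) (·-closed (K.-‿closed K.1∈) x∈X)

    cancelʳ : ∀ {x y z} → x ≈ y + z → x ∈ X → z ∈ X → y ∈ X
    cancelʳ {x} {y} {z} x≈y+z x∈X z∈X = resp eq (+-closed x∈X (-‿closed z∈X))
      where
      open ≈-Reasoning
      eq : x - z ≈ y
      eq = begin
        x - z        ≈⟨ +-congʳ x≈y+z ⟩
        y + z - z    ≈⟨ +-assoc y z (- z) ⟩
        y + (z - z)  ≈⟨ +-congˡ (-‿inverseʳ z) ⟩
        y + 0#       ≈⟨ +-identityʳ y ⟩
        y            ∎

    cancel· : ∀ {k x} → k ∈ K → ¬ k ≈ 0# → k * x ∈ X → x ∈ X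
    cancel· k∈K k≉0 kx∈X with inverse∈K k∈K k≉0
    ... | l , l∈K , lk≈1 = resp (cancel-inverse _ lk≈1) (·-closed l∈K kx∈X)

    -- A nonzero `k` could be divided out, which would put `x` in `X`. This serves wherever a linear
    -- relation is read modulo a subspace.
    coefficient≈0 : ∀ {k x y z} → k ∈ K → x ∉ X → y ∈ X → z ∈ X → z ≈ k * x + y → k ≈ 0#
    coefficient≈0 {k} k∈K x∉X y∈X z∈X eq with dec≈ k 0#
    ... | yes k≈0 = k≈0
    ... | no  k≉0 = contradiction (cancel· k∈K k≉0 (cancelʳ eq z∈X y∈X)) x∉X

    combination-closed : ∀ {n} {k v : Vector Carrier n} →
      (∀ i → k i ∈ K) → (∀ i → v i ∈ X) → combination k v ∈ X
    combination-closed {zero}  k∈K v∈X = 0∈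
    combination-closed {ℕ.suc n} k∈K v∈X =
      +-closed (·-closed (k∈K zero) (v∈X zero)) (combination-closed (k∈K ∘ Fin.suc) (v∈X ∘ Fin.suc))

    Span⊆ : ∀ {s} {S : Pred Carrier s} → S ⊆ X → Span S ⊆ X
    Span⊆ S⊆X (n , k , v , k∈K , v∈S , x≈) =
      resp (sym x≈) (combination-closed k∈K (S⊆X ∘ v∈S))

  -- Linear combinations, spans and the exchange lemma

  combination-0 : ∀ {n} (v : Vector Carrier n) → combination (λ _ → 0#) v ≈ 0#
  combination-0 {n} v = trans (sum-cong-≋ (λ i → zeroˡ (v i))) (sum-replicate-zero n)

  combination-+ : ∀ {n} (k l v : Vector Carrier n) →
    combination (λ i → k i + l i) v ≈ combination k v + combination l v
  combination-+ k l v = trans (sum-cong-≋ (λ i → distribʳ (v i) (k i) (l i))) (∑-distrib-+ (λ i → k i * v i) (λ i → l i * v i))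

  combination-* : ∀ {n} a (k v : Vector Carrier n) →
    combination (λ i → a * k i) v ≈ a * combination k v
  combination-* a k v =
    trans (sum-cong-≋ (λ i → *-assoc a (k i) (v i))) (sym (*-distribˡ-sum a (λ i → k i * v i)))

  combination-*ʳ : ∀ {n} a (k v : Vector Carrier n) →
    combination k (λ i → a * v i) ≈ a * combination k v
  combination-*ʳ a k v = trans
    (sum-cong-≋ (λ i → solve 3 (λ a k v → k :* (a :* v) := a :* (k :* v)) refl a (k i) (v i)))
    (sym (*-distribˡ-sum a (λ i → k i * v i)))

  -- One coefficient per entry of `v`, whereas `Span (Range v)` allows any length and repetitions.
  -- The fixed length makes coefficients addressable by index; `LinSpan⊆Span` and `Span⊆LinSpan`
  -- show that the two subspaces agree.
  LinSpan : ∀ {n} → Vector Carrier n → Subset L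
  LinSpan v x = ∃[ k ] (∀ i → k i ∈ K) × x ≈ combination k v

  LinSpan-isSubspace : ∀ {n} (v : Vector Carrier n) → IsSubspace (LinSpan v)
  LinSpan-isSubspace v = record
    { resp     = λ { x≈y (k , k∈K , x≈) → k , k∈K , trans (sym x≈y) x≈ }
    ; 0∈       = (λ _ → 0#) , (λ _ → K.0∈) , sym (combination-0 v)
    ; +-closed = λ { (k , k∈K , x≈) (l , l∈K , y≈) →
        _ , (λ i → K.+-closed (k∈K i) (l∈K i)) , trans (+-cong x≈ y≈) (sym (combination-+ k l v)) }
    ; ·-closed = λ { {a} a∈K (k , k∈K , x≈) →
        _ , (λ i → K.*-closed a∈K (k∈K i)) , trans (*-congˡ x≈) (sym (combination-* a k v)) }
    }

  ∷∈K : ∀ {n k} {l : Vector Carrier n} → k ∈ K → (∀ i → l i ∈ K) → ∀ i → (k ∷ l) i ∈ K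
  ∷∈K k∈K l∈K zero          = k∈K
  ∷∈K k∈K l∈K (Fin.suc i) = l∈K i

  member∈LinSpan : ∀ {n} (v : Vector Carrier n) i → v i ∈ LinSpan v
  member∈LinSpan {ℕ.suc n} v zero = 1# ∷ (λ _ → 0#) , ∷∈K K.1∈ (λ _ → K.0∈) ,
    sym (trans (+-cong (*-identityˡ _) (combination-0 (tail v))) (+-identityʳ _))
  member∈LinSpan {ℕ.suc n} v (Fin.suc i) with member∈LinSpan (tail v) i
  ... | k , k∈K , eq = 0# ∷ k , ∷∈K K.0∈ k∈K ,
    trans eq (sym (trans (+-congʳ (zeroˡ _)) (+-identityˡ _)))

  LinSpan⊆Span : ∀ {n} (v : Vector Carrier n) → LinSpan v ⊆ Span (Range v)
  LinSpan⊆Span v (k , k∈K , eq) = _ , k , v , k∈K , (λ i → i , refl) , eq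

  Range⊆ : ∀ {X n} {v : Vector Carrier n} → IsSubspace X → (∀ i → v i ∈ X) → Range v ⊆ X
  Range⊆ X-sub v∈X (i , x≈vi) = IsSubspace.resp X-sub (sym x≈vi) (v∈X i)

  Span⊆LinSpan : ∀ {n} (v : Vector Carrier n) → Span (Range v) ⊆ LinSpan v
  Span⊆LinSpan v = Subspace.Span⊆ sub (Range⊆ sub (member∈LinSpan v))
    where sub = LinSpan-isSubspace v

  -- Gaussian elimination: subtracting multiples of v p clears the first
  -- coordinate of every other vector.
  steinitz : ∀ {m n} (v : Vector Carrier m) (w : Vector Carrier n) →
    LinearlyIndependent v → (∀ i → v i ∈ LinSpan w) → m ℕ.≤ n
  steinitz {zero}  {n}     v w ind v∈ = z≤n
  steinitz {ℕ.suc m} {zero}  v w ind v∈ = contradiction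
    (ind (1# ∷ (λ _ → 0#)) (∷∈K K.1∈ (λ _ → K.0∈))
      (trans (+-cong (trans (*-identityˡ _) (proj₂ (proj₂ (v∈ zero)))) (combination-0 (tail v))) (+-identityʳ _))
      zero)
    1≉0
  steinitz {ℕ.suc m} {ℕ.suc n} v w ind v∈ = eliminate dec
    where
    k : Fin (ℕ.suc m) → Vector Carrier (ℕ.suc n)
    k i = proj₁ (v∈ i)
    k∈K : ∀ i j → k i j ∈ K
    k∈K i = proj₁ (proj₂ (v∈ i))
    rest : Fin (ℕ.suc m) → Carrier
    rest i = combination (tail (k i)) (tail w)
    v≈ : ∀ i → v i ≈ k i zero * w zero + rest i
    v≈ i = proj₂ (proj₂ (v∈ i))
    rest∈ : ∀ i → rest i ∈ LinSpan (tail w)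
    rest∈ i = tail (k i) , k∈K i ∘ Fin.suc , refl
    open Subspace (LinSpan-isSubspace (tail w)) using (resp; +-closed; ·-closed)

    eliminate : Dec (Lift c (∃[ p ] ¬ k p zero ≈ 0#)) → ℕ.suc m ℕ.≤ ℕ.suc n
    eliminate (no none) = ℕ.m≤n⇒m≤1+n (steinitz v (tail w) ind
      (λ i → resp (sym (trans (v≈ i) (trans (+-congʳ (trans (*-congʳ (k≈0 i)) (zeroˡ _))) (+-identityˡ _))))
        (rest∈ i)))
      where
      k≈0 : ∀ i → k i zero ≈ 0#
      k≈0 i = decidable-stable (dec≈ _ _) (λ k≉0 → none (lift (i , k≉0)))
    eliminate (yes (lift (p , kp≉0))) = s≤s (steinitz v′ (tail w) ind′ v′∈)
      where
      open ≈-Reasoning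
      b : Carrier
      b = k p zero
      b⁻¹ : ∃[ l ] l ∈ K × l * b ≈ 1#
      b⁻¹ = inverse∈K (k∈K p zero) kp≉0
      s : Vector Carrier m
      s j = - (k (punchIn p j) zero * proj₁ b⁻¹)
      s∈K : ∀ j → s j ∈ K
      s∈K j = K.-‿closed (K.*-closed (k∈K (punchIn p j) zero) (proj₁ (proj₂ b⁻¹)))
      a+sb≈0 : ∀ j → k (punchIn p j) zero + s j * b ≈ 0#
      a+sb≈0 j = begin
        a + s j * b                ≈⟨ +-congˡ (-‿distribˡ-* _ b) ⟨
        a - a * proj₁ b⁻¹ * b      ≈⟨ +-congˡ (-‿cong (*-assoc _ _ b)) ⟩
        a - a * (proj₁ b⁻¹ * b)    ≈⟨ +-congˡ (-‿cong (*-congˡ (proj₂ (proj₂ b⁻¹)))) ⟩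
        a - a * 1#                 ≈⟨ +-congˡ (-‿cong (*-identityʳ _)) ⟩
        a - a                      ≈⟨ -‿inverseʳ _ ⟩
        0#                         ∎
        where a = k (punchIn p j) zero
      v′ : Vector Carrier m
      v′ j = v (punchIn p j) + s j * v p
      v′∈ : ∀ j → v′ j ∈ LinSpan (tail w)
      v′∈ j = resp (sym eq) (+-closed (rest∈ (punchIn p j)) (·-closed (s∈K j) (rest∈ p)))
        where
        a = k (punchIn p j) zero
        x = rest (punchIn p j)
        y = rest p
        eq : v′ j ≈ x + s j * y
        eq = begin
          v (punchIn p j) + s j * v p
            ≈⟨ +-cong (v≈ (punchIn p j)) (*-congˡ (v≈ p)) ⟩
          (a * w zero + x) + s j * (b * w zero + y)
            ≈⟨ solve 6 (λ a w x s b y → (a :* w :+ x) :+ s :* (b :* w :+ y)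
                 := (a :+ s :* b) :* w :+ (x :+ s :* y)) refl a (w zero) x (s j) b y ⟩
          (a + s j * b) * w zero + (x + s j * y)
            ≈⟨ +-congʳ (trans (*-congʳ (a+sb≈0 j)) (zeroˡ _)) ⟩
          0# + (x + s j * y)
            ≈⟨ +-identityˡ _ ⟩
          x + s j * y ∎
      ind′ : LinearlyIndependent v′
      ind′ l l∈K lv′≈0 j = trans (reflexive (≡.sym (insertAt-punchIn l p r j)))
          (ind l̃ l̃∈K l̃v≈0 (punchIn p j))
        where
        -- The total coefficient of `v p` once every `v′ j` is expanded, so that `l̃` is the same
        -- relation written in the entries of `v`.
        r = sum (λ j → l j * s j)
        l̃ = insertAt l p r
        l̃∈K : ∀ i → l̃ i ∈ K
        l̃∈K i with p Fin.≟ i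
        ... | yes ≡.refl = K.resp (reflexive (≡.sym (insertAt-lookup l p r))) (sum∈K (λ j → K.*-closed (l∈K j) (s∈K j)))
          where
          sum∈K : ∀ {n} {t : Vector Carrier n} → (∀ i → t i ∈ K) → sum t ∈ K
          sum∈K {zero}  t∈K = K.0∈
          sum∈K {ℕ.suc n} t∈K = K.+-closed (t∈K zero) (sum∈K (t∈K ∘ Fin.suc))
        ... | no p≢i = ≡.subst (λ i → l̃ i ∈ K) (Fin.punchIn-punchOut p≢i)
          (K.resp (reflexive (≡.sym (insertAt-punchIn l p r _))) (l∈K (punchOut p≢i)))
        l̃v≈0 : combination l̃ v ≈ 0#
        l̃v≈0 = begin
          combination l̃ v
            ≈⟨ sum-remove {i = p} (λ i → l̃ i * v i) ⟩
          l̃ p * v p + sum (λ j → l̃ (punchIn p j) * v (punchIn p j))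
            ≈⟨ +-cong (*-congʳ (reflexive (insertAt-lookup l p r)))
                      (sum-cong-≋ (λ j → *-congʳ (reflexive (insertAt-punchIn l p r j)))) ⟩
          r * v p + sum (λ j → l j * v (punchIn p j))
            ≈⟨ +-congʳ (*-distribʳ-sum (v p) (λ j → l j * s j)) ⟩
          sum (λ j → l j * s j * v p) + sum (λ j → l j * v (punchIn p j))
            ≈⟨ ∑-distrib-+ (λ j → l j * s j * v p) (λ j → l j * v (punchIn p j)) ⟨
          sum (λ j → l j * s j * v p + l j * v (punchIn p j))
            ≈⟨ sum-cong-≋ (λ j → solve 4 (λ l s x y → l :* s :* x :+ l :* y := l :* (y :+ s :* x))
                 refl (l j) (s j) (v p) (v (punchIn p j))) ⟩
          combination l v′
            ≈⟨ lv′≈0 ⟩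
          0# ∎

  HasDimension-resp-≐ : ∀ {X Y n} → X ≐ Y → HasDimension X n → HasDimension Y n
  HasDimension-resp-≐ (X⊆Y , Y⊆X) (v , basis) = v , record
    { members     = X⊆Y ∘ members
    ; independent = independent
    ; spanning    = spanning ∘ Y⊆X
    }
    where open IsBasis basis

  HasDimension-mono : ∀ {X Y m n} → X ⊆ Y → HasDimension X m → HasDimension Y n → m ℕ.≤ n
  HasDimension-mono X⊆Y (v , v-basis) (w , w-basis) = steinitz v w (IsBasis.independent v-basis)
    (Span⊆LinSpan w ∘ IsBasis.spanning w-basis ∘ X⊆Y ∘ IsBasis.members v-basis)

  Line : Carrier → Subset L
  Line x y = ∃[ k ] k ∈ K × y ≈ k * x

  Line-isSubspace : ∀ x → IsSubspace (Line x)
  Line-isSubspace x = record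
    { resp     = λ { y≈z (k , k∈K , y≈) → k , k∈K , trans (sym y≈z) y≈ }
    ; 0∈       = 0# , K.0∈ , sym (zeroˡ x)
    ; +-closed = λ { (k , k∈K , y≈) (l , l∈K , z≈) →
        k + l , K.+-closed k∈K l∈K , trans (+-cong y≈ z≈) (sym (distribʳ x k l)) }
    ; ·-closed = λ { {a} a∈K (k , k∈K , y≈) →
        a * k , K.*-closed a∈K k∈K , trans (*-congˡ y≈) (sym (*-assoc a k x)) }
    }

  ⊞-isSubspace : ∀ {X Y} → IsSubspace X → IsSubspace Y → IsSubspace (X ⊞ Y)
  ⊞-isSubspace X-sub Y-sub = record
    { resp     = λ { z≈w (x , y , x∈ , y∈ , z≈) → x , y , x∈ , y∈ , trans (sym z≈w) z≈ }
    ; 0∈       = 0# , 0# , X.0∈ , Y.0∈ , sym (+-identityˡ 0#)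
    ; +-closed = λ { (x , y , x∈ , y∈ , z≈) (x′ , y′ , x′∈ , y′∈ , z′≈) →
        x + x′ , y + y′ , X.+-closed x∈ x′∈ , Y.+-closed y∈ y′∈ ,
        trans (+-cong z≈ z′≈)
          (solve 4 (λ x y x′ y′ → (x :+ y) :+ (x′ :+ y′) := (x :+ x′) :+ (y :+ y′)) refl x y x′ y′) }
    ; ·-closed = λ { {k} k∈K (x , y , x∈ , y∈ , z≈) →
        k * x , k * y , X.·-closed k∈K x∈ , Y.·-closed k∈K y∈ , trans (*-congˡ z≈) (distribˡ k x y) }
    }
    where
    module X = IsSubspace X-sub
    module Y = IsSubspace Y-sub

  ⊞-upperˡ : ∀ {X Y} → IsSubspace Y → X ⊆ X ⊞ Y
  ⊞-upperˡ Y-sub {x} x∈X = x , 0# , x∈X , IsSubspace.0∈ Y-sub , sym (+-identityʳ x)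

  ⊞-upperʳ : ∀ {X Y} → IsSubspace X → Y ⊆ X ⊞ Y
  ⊞-upperʳ X-sub {y} y∈Y = 0# , y , IsSubspace.0∈ X-sub , y∈Y , sym (+-identityˡ y)

  ⊞-least : ∀ {X Y Z} → IsSubspace Z → X ⊆ Z → Y ⊆ Z → X ⊞ Y ⊆ Z
  ⊞-least Z-sub X⊆Z Y⊆Z (x , y , x∈ , y∈ , z≈) = Z.resp (sym z≈) (Z.+-closed (X⊆Z x∈) (Y⊆Z y∈))
    where module Z = IsSubspace Z-sub

  Line-least : ∀ {x Z} → IsSubspace Z → x ∈ Z → Line x ⊆ Z
  Line-least Z-sub x∈Z (k , k∈K , y≈) = Z.resp (sym y≈) (Z.·-closed k∈K x∈Z)
    where module Z = IsSubspace Z-sub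

  x∈Line : ∀ x → x ∈ Line x
  x∈Line x = 1# , K.1∈ , sym (*-identityˡ x)

  HasDimension-⊞Line : ∀ {X n x} → IsSubspace X → HasDimension X n → x ∉ X →
    HasDimension (X ⊞ Line x) (ℕ.suc n)
  HasDimension-⊞Line {X} {n} {x} X-sub (v , basis) x∉X = x ∷ v , record
    { members     = λ { zero → ⊞-upperʳ X-sub (x∈Line x)
                      ; (Fin.suc i) → ⊞-upperˡ (Line-isSubspace x) (members i) }
    ; independent = ind
    ; spanning    = λ { (y , z , y∈X , (k , k∈K , z≈) , w≈) →
        let (l , l∈K , y≈) = Span⊆LinSpan v (spanning y∈X) in
        LinSpan⊆Span (x ∷ v) (k ∷ l , ∷∈K k∈K l∈K ,
          trans w≈ (trans (+-cong y≈ z≈) (+-comm _ _))) }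
    }
    where
    open IsBasis basis
    open Subspace X-sub
    ind : LinearlyIndependent (x ∷ v)
    ind k k∈K eq = λ { zero → k0≈0 ; (Fin.suc i) → independent (tail k) (k∈K ∘ Fin.suc) rest≈0 i }
      where
      k0≈0 : k zero ≈ 0#
      k0≈0 = coefficient≈0 (k∈K zero) x∉X (combination-closed (k∈K ∘ Fin.suc) members) 0∈ (sym eq)
      rest≈0 : combination (tail k) v ≈ 0#
      rest≈0 = trans (sym (trans (+-congʳ (trans (*-congʳ k0≈0) (zeroˡ x))) (+-identityˡ _))) eq

  -- Finite-dimensional subspaces and Grassmann's formula

  -- Bundling a basis makes `dim` a function. Equality of subspaces is mutual inclusion, and
  -- `dim-cong` shows that the chosen basis does not affect the dimension.
  record FinSubspace : Set (suc (c ⊔ ℓ)) where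
    field
      carrier      : Subset L
      isSubspace   : IsSubspace carrier
      {dim}        : ℕ
      hasDimension : HasDimension carrier dim
    open Subspace isSubspace public

  open FinSubspace using (carrier; isSubspace; dim; hasDimension)

  infix 4 _≤ₛ_ _∈ₛ_ _∉ₛ_

  _∈ₛ_ _∉ₛ_ : Carrier → FinSubspace → Set (c ⊔ ℓ)
  x ∈ₛ X = x ∈ carrier X
  x ∉ₛ X = x ∉ carrier X

  _≤ₛ_ : FinSubspace → FinSubspace → Set (c ⊔ ℓ)
  X ≤ₛ Y = carrier X ⊆ carrier Y

  dim-mono : ∀ X Y → X ≤ₛ Y → dim X ℕ.≤ dim Y
  dim-mono X Y X≤Y = HasDimension-mono X≤Y (hasDimension X) (hasDimension Y)

  dim-cong : ∀ X Y → X ≤ₛ Y → Y ≤ₛ X → dim X ≡ dim Y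
  dim-cong X Y X≤Y Y≤X = ℕ.≤-antisym (dim-mono X Y X≤Y) (dim-mono Y X Y≤X)

  linSpan : ∀ {n} (v : Vector Carrier n) → LinearlyIndependent v → FinSubspace
  linSpan v ind = record
    { carrier      = LinSpan v
    ; isSubspace   = LinSpan-isSubspace v
    ; hasDimension = v , record
        { members = member∈LinSpan v ; independent = ind ; spanning = LinSpan⊆Span v }
    }

  zeroSpace : FinSubspace
  zeroSpace = linSpan [] λ _ _ _ ()

  adjoin : (X : FinSubspace) {x : Carrier} → x ∉ₛ X → FinSubspace
  adjoin X {x} x∉X = record
    { carrier      = carrier X ⊞ Line x
    ; isSubspace   = ⊞-isSubspace (isSubspace X) (Line-isSubspace x)
    ; hasDimension = HasDimension-⊞Line (isSubspace X) (hasDimension X) x∉X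
    }

  adjoin-upper : ∀ X {x} (x∉X : x ∉ₛ X) → X ≤ₛ adjoin X x∉X
  adjoin-upper X x∉X = ⊞-upperˡ (Line-isSubspace _)

  x∈adjoin : ∀ X {x} (x∉X : x ∉ₛ X) → x ∈ₛ adjoin X x∉X
  x∈adjoin X {x} x∉X = ⊞-upperʳ (isSubspace X) (x∈Line x)

  adjoin-least : ∀ X {x Y} (x∉X : x ∉ₛ X) → IsSubspace Y → carrier X ⊆ Y → x ∈ Y →
    carrier (adjoin X x∉X) ⊆ Y
  adjoin-least X x∉X Y-sub X⊆Y x∈Y = ⊞-least Y-sub X⊆Y (Line-least Y-sub x∈Y)

  ⊆-stable : ∀ {X Y : Subset L} → ¬ (∃[ x ] x ∈ X × x ∉ Y) → X ⊆ Y
  ⊆-stable none {x} x∈X = decidable-stable dec (λ x∉Y → none (x , x∈X , x∉Y))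

  -- A vector of `Y` outside `X` could be adjoined to `X` without leaving `Y`, and the dimension
  -- would then be too large.
  dim-equal : ∀ X Y → X ≤ₛ Y → dim Y ℕ.≤ dim X → Y ≤ₛ X
  dim-equal X Y X≤Y dimY≤dimX = ⊆-stable {carrier Y} {carrier X} λ { (y , y∈Y , y∉X) →
    ℕ.<⇒≱ (dim-mono (adjoin X y∉X) Y (adjoin-least X y∉X (isSubspace Y) X≤Y y∈Y)) dimY≤dimX }

  -- While `Z` is smaller than `X`, excluded middle supplies a vector of `X` outside `Z` to adjoin.
  -- Each one raises the dimension, which `dim Y` bounds, so `dim Y` rounds suffice. `P` carries
  -- what should be known of the final subspace: nothing when only a basis is wanted, a dimension
  -- count for Grassmann's formula.
  grow : ∀ {p} (P : FinSubspace → Set p) {X : Subset L} → IsSubspace X →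
    (Y : FinSubspace) → X ⊆ carrier Y →
    (∀ Z {x} (x∉Z : x ∉ₛ Z) → carrier Z ⊆ X → x ∈ X → P Z → P (adjoin Z x∉Z)) →
    (Z : FinSubspace) → carrier Z ⊆ X → P Z → ∃[ Z′ ] P Z′ × carrier Z′ ≐ X
  grow P {X} X-sub Y X⊆Y step Z Z⊆X PZ = go (dim Y) Z Z⊆X PZ (ℕ.m≤m+n (dim Y) (dim Z))
    where
    go : ∀ fuel (Z : FinSubspace) → carrier Z ⊆ X → P Z → dim Y ℕ.≤ fuel ℕ.+ dim Z →
      ∃[ Z′ ] P Z′ × carrier Z′ ≐ X
    go fuel Z Z⊆X PZ dimY≤ with dec {∃[ x ] x ∈ X × x ∉ₛ Z}
    ... | no none = Z , PZ , Z⊆X , ⊆-stable none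
    go zero Z Z⊆X PZ dimY≤ | yes (x , x∈X , x∉Z) =
      contradiction dimY≤ (ℕ.<⇒≱ (dim-mono (adjoin Z x∉Z) Y (X⊆Y ∘ adjoin-least Z x∉Z X-sub Z⊆X x∈X)))
    go (ℕ.suc fuel) Z Z⊆X PZ dimY≤ | yes (x , x∈X , x∉Z) =
      go fuel (adjoin Z x∉Z) (adjoin-least Z x∉Z X-sub Z⊆X x∈X) (step Z x∉Z Z⊆X x∈X PZ)
        (ℕ.≤-trans dimY≤ (ℕ.≤-reflexive (≡.sym (ℕ.+-suc fuel (dim Z)))))

  zeroSpace-least : ∀ {X} → IsSubspace X → carrier zeroSpace ⊆ X
  zeroSpace-least X-sub (_ , _ , x≈0) = IsSubspace.resp X-sub (sym x≈0) (IsSubspace.0∈ X-sub)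

  -- Bases of derived subspaces are kept abstract so that dimensions do not
  -- unfold to the process that produced them.
  abstract
    subspace-dimension : ∀ {X} → IsSubspace X → (Y : FinSubspace) → X ⊆ carrier Y → ∃ (HasDimension X)
    subspace-dimension {X} X-sub Y X⊆Y with grow (λ _ → ⊤) X-sub Y X⊆Y (λ _ _ _ _ _ → tt) zeroSpace (zeroSpace-least X-sub) tt
    ... | Z , _ , Z≐X = dim Z , HasDimension-resp-≐ Z≐X (hasDimension Z)

  restrict : ∀ {X} → IsSubspace X → (Y : FinSubspace) → X ⊆ carrier Y → FinSubspace
  restrict {X} X-sub Y X⊆Y = record
    { carrier      = X
    ; isSubspace   = X-sub
    ; hasDimension = proj₂ (subspace-dimension X-sub Y X⊆Y)
    }

  ∩-isSubspace : ∀ {X Y} → IsSubspace X → IsSubspace Y → IsSubspace (X ∩ Y)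
  ∩-isSubspace X-sub Y-sub = record
    { resp     = λ { x≈y (x∈X , x∈Y) → X.resp x≈y x∈X , Y.resp x≈y x∈Y }
    ; 0∈       = X.0∈ , Y.0∈
    ; +-closed = λ { (x∈X , x∈Y) (y∈X , y∈Y) → X.+-closed x∈X y∈X , Y.+-closed x∈Y y∈Y }
    ; ·-closed = λ { k∈K (x∈X , x∈Y) → X.·-closed k∈K x∈X , Y.·-closed k∈K x∈Y }
    }
    where
    module X = IsSubspace X-sub
    module Y = IsSubspace Y-sub

  infixr 7 _⊓_
  infixr 6 _⊔ₛ_

  _⊓_ : FinSubspace → FinSubspace → FinSubspace
  X ⊓ Y = restrict (∩-isSubspace (isSubspace X) (isSubspace Y)) X proj₁

  abstract
    -- Grassmann's formula, by growing X ∩ Y to Y one vector at a time.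
    ⊞-dimension : ∀ X Y → ∃[ d ]
      HasDimension (carrier X ⊞ carrier Y) d × d ℕ.+ dim (X ⊓ Y) ≡ dim X ℕ.+ dim Y
    ⊞-dimension X Y with grow P (isSubspace Y) Y id step (X ⊓ Y) proj₂ base
      where
      P : FinSubspace → Set (c ⊔ ℓ)
      P Z = carrier (X ⊓ Y) ⊆ carrier Z ×
        ∃[ d ] HasDimension (carrier X ⊞ carrier Z) d × d ℕ.+ dim (X ⊓ Y) ≡ dim X ℕ.+ dim Z
      base : P (X ⊓ Y)
      base = id , dim X , HasDimension-resp-≐
        (⊞-upperˡ (isSubspace (X ⊓ Y)) , ⊞-least (isSubspace X) id proj₁) (hasDimension X) , ≡.refl
      step : ∀ Z {x} (x∉Z : x ∉ₛ Z) → Z ≤ₛ Y → x ∈ₛ Y → P Z → P (adjoin Z x∉Z)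
      step Z {x} x∉Z Z≤Y x∈Y (X∩Y⊆Z , d , hasDim , eq) =
        adjoin-upper Z x∉Z ∘ X∩Y⊆Z , ℕ.suc d ,
        HasDimension-resp-≐ (left , right) (HasDimension-⊞Line X⊞Z-sub hasDim x∉X⊞Z) ,
        ≡.trans (≡.cong ℕ.suc eq) (≡.sym (ℕ.+-suc (dim X) (dim Z)))
        where
        X⊞Z-sub : IsSubspace (carrier X ⊞ carrier Z)
        X⊞Z-sub = ⊞-isSubspace (isSubspace X) (isSubspace Z)
        Z+x : FinSubspace
        Z+x = adjoin Z x∉Z
        X⊞Z+x-sub : IsSubspace (carrier X ⊞ carrier Z+x)
        X⊞Z+x-sub = ⊞-isSubspace (isSubspace X) (isSubspace Z+x)
        x∉X⊞Z : x ∉ carrier X ⊞ carrier Z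
        x∉X⊞Z (y , z , y∈X , z∈Z , x≈y+z) = x∉Z (FinSubspace.resp Z (sym x≈y+z)
          (FinSubspace.+-closed Z (X∩Y⊆Z (y∈X , FinSubspace.cancelʳ Y x≈y+z x∈Y (Z≤Y z∈Z))) z∈Z))
        left : (carrier X ⊞ carrier Z) ⊞ Line x ⊆ carrier X ⊞ carrier Z+x
        left = ⊞-least X⊞Z+x-sub
          (⊞-least X⊞Z+x-sub (⊞-upperˡ (isSubspace Z+x)) (⊞-upperʳ (isSubspace X) ∘ adjoin-upper Z x∉Z))
          (Line-least X⊞Z+x-sub (⊞-upperʳ (isSubspace X) (x∈adjoin Z x∉Z)))
        right : carrier X ⊞ carrier Z+x ⊆ (carrier X ⊞ carrier Z) ⊞ Line x
        right = ⊞-least sub (⊞-upperˡ (Line-isSubspace x) ∘ ⊞-upperˡ (isSubspace Z))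
          (adjoin-least Z x∉Z sub (⊞-upperˡ (Line-isSubspace x) ∘ ⊞-upperʳ (isSubspace X))
            (⊞-upperʳ X⊞Z-sub (x∈Line x)))
          where
          sub : IsSubspace ((carrier X ⊞ carrier Z) ⊞ Line x)
          sub = ⊞-isSubspace X⊞Z-sub (Line-isSubspace x)
    ... | Z , (_ , d , hasDim , eq) , Z⊆Y , Y⊆Z = d ,
      HasDimension-resp-≐
        (⊞-least X⊞Y-sub (⊞-upperˡ (isSubspace Y)) (⊞-upperʳ (isSubspace X) ∘ Z⊆Y) ,
         ⊞-least (⊞-isSubspace (isSubspace X) (isSubspace Z))
           (⊞-upperˡ (isSubspace Z)) (⊞-upperʳ (isSubspace X) ∘ Y⊆Z)) hasDim ,
      ≡.trans eq (≡.cong (dim X ℕ.+_) (dim-cong Z Y Z⊆Y Y⊆Z))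
      where
      X⊞Y-sub : IsSubspace (carrier X ⊞ carrier Y)
      X⊞Y-sub = ⊞-isSubspace (isSubspace X) (isSubspace Y)

  _⊔ₛ_ : FinSubspace → FinSubspace → FinSubspace
  X ⊔ₛ Y = record
    { carrier      = carrier X ⊞ carrier Y
    ; isSubspace   = ⊞-isSubspace (isSubspace X) (isSubspace Y)
    ; hasDimension = proj₁ (proj₂ (⊞-dimension X Y))
    }

  dim-⊔-⊓ : ∀ X Y → dim (X ⊔ₛ Y) ℕ.+ dim (X ⊓ Y) ≡ dim X ℕ.+ dim Y
  dim-⊔-⊓ X Y = proj₂ (proj₂ (⊞-dimension X Y))

  scale : ∀ {e} → ¬ e ≈ 0# → FinSubspace → FinSubspace
  scale {e} e≉0 X = record
    { carrier      = λ y → ∃[ x ] x ∈ₛ X × y ≈ e * x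
    ; isSubspace   = record
      { resp     = λ { y≈z (x , x∈ , y≈) → x , x∈ , trans (sym y≈z) y≈ }
      ; 0∈       = 0# , X.0∈ , sym (zeroʳ e)
      ; +-closed = λ { (x , x∈ , y≈) (x′ , x′∈ , y′≈) →
          x + x′ , X.+-closed x∈ x′∈ , trans (+-cong y≈ y′≈) (sym (distribˡ e x x′)) }
      ; ·-closed = λ { {k} k∈K (x , x∈ , y≈) → k * x , X.·-closed k∈K x∈ ,
          trans (*-congˡ y≈) (solve 3 (λ k e x → k :* (e :* x) := e :* (k :* x)) refl k e x) }
      }
    ; hasDimension = (λ i → e * v i) , record
      { members     = λ i → v i , members i , refl
      ; independent = λ k k∈K eq → independent k k∈K (begin
          combination k v              ≈⟨ cancel-inverse _ (proj₂ e⁻¹) ⟨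
          proj₁ e⁻¹ * (e * combination k v)  ≈⟨ *-congˡ (trans (sym (combination-*ʳ e k v)) eq) ⟩
          proj₁ e⁻¹ * 0#                ≈⟨ zeroʳ _ ⟩
          0#                           ∎)
      ; spanning    = λ { (x , x∈ , y≈) →
          let (k , k∈K , x≈) = Span⊆LinSpan v (spanning x∈) in
          LinSpan⊆Span (λ i → e * v i) (k , k∈K ,
            trans y≈ (trans (*-congˡ x≈) (sym (combination-*ʳ e k v)))) }
      }
    }
    where
    open ≈-Reasoning
    module X = FinSubspace X
    v = proj₁ (hasDimension X)
    open IsBasis (proj₂ (hasDimension X))
    e⁻¹ = inverse e≉0

  nonzero⇒1≤dim : ∀ X {x} → x ∈ₛ X → ¬ x ≈ 0# → 1 ℕ.≤ dim X
  nonzero⇒1≤dim X x∈X x≉0 = dim-mono (adjoin zeroSpace x∉0) X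
    (adjoin-least zeroSpace x∉0 (isSubspace X) (zeroSpace-least (isSubspace X)) x∈X)
    where
    x∉0 = λ x∈0 → x≉0 (proj₂ (proj₂ x∈0))

  1≤dim⇒nonzero : ∀ X → 1 ℕ.≤ dim X → ∃[ x ] x ∈ₛ X × ¬ x ≈ 0#
  1≤dim⇒nonzero X 1≤dim with dec {∃[ x ] x ∈ₛ X × x ∉ₛ zeroSpace}
  ... | yes (x , x∈X , x∉0) = x , x∈X , λ x≈0 → x∉0 ([] , (λ ()) , x≈0)
  ... | no  none = contradiction (dim-mono X zeroSpace (⊆-stable none)) (ℕ.<⇒≱ 1≤dim)


  -- The linear Rado theorem

  module Rado (B : FinSubspace) where

    Family : ℕ → Set (suc (c ⊔ ℓ))
    Family m = Fin m → FinSubspace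

    infix 4 _≤ᶠ_

    _≤ᶠ_ : ∀ {m} → Family m → Family m → Set (c ⊔ ℓ)
    V ≤ᶠ H = ∀ j → V j ≤ₛ H j

    -- Including `B` in the intersection makes the meet over the empty set `B` itself and keeps
    -- every meet finite-dimensional.
    meet : ∀ {m} → Family m → FS.Subset m → FinSubspace
    meet V J = restrict {X = λ x → x ∈ₛ B × (∀ i → i FS.∈ J → x ∈ₛ V i)} (record
      { resp     = λ { x≈y (x∈B , x∈V) → FinSubspace.resp B x≈y x∈B , λ i i∈J → FinSubspace.resp (V i) x≈y (x∈V i i∈J) }
      ; 0∈       = FinSubspace.0∈ B , λ i _ → FinSubspace.0∈ (V i)
      ; +-closed = λ { (x∈B , x∈V) (y∈B , y∈V) → FinSubspace.+-closed B x∈B y∈B ,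
          λ i i∈J → FinSubspace.+-closed (V i) (x∈V i i∈J) (y∈V i i∈J) }
      ; ·-closed = λ { k∈K (x∈B , x∈V) → FinSubspace.·-closed B k∈K x∈B ,
          λ i i∈J → FinSubspace.·-closed (V i) k∈K (x∈V i i∈J) }
      }) B proj₁

    -- Rado's rank condition in dual form: the annihilators of the `V j` in `B`, for j in `J`,
    -- together span a space of dimension `dim B` minus `dim (meet V J)`, which has to be at least
    -- the size of `J`.
    Hall : ∀ {m} → Family m → Set
    Hall V = ∀ J → dim (meet V J) ℕ.+ ∣ J ∣ ℕ.≤ dim B

    Violation : ∀ {m} → Family m → FS.Subset m → Set
    Violation V J = dim B ℕ.< dim (meet V J) ℕ.+ ∣ J ∣

    hall⊎violation : ∀ {m} (V : Family m) → Hall V ⊎ ∃ (Violation V)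
    hall⊎violation V with FS.anySubset? (λ J → dim B ℕ.<? dim (meet V J) ℕ.+ ∣ J ∣)
    ... | yes violation = inj₂ violation
    ... | no  none      = inj₁ (λ J → ℕ.≮⇒≥ (λ violation → none (J , violation)))

    replace : ∀ {m} → Family m → Fin m → FinSubspace → Family m
    replace V i X = updateAt V i (const X)

    replace-at : ∀ {m} (V : Family m) i X → replace V i X i ≡ X
    replace-at V i X = updateAt-updates i V

    replace-off : ∀ {m} (V : Family m) {i j} X → j ≢ i → replace V i X j ≡ V j
    replace-off V X j≢i = updateAt-minimal _ _ V j≢i

    -- If `i` were outside `J`, the replacement would not affect the meet over `J`, and `V` itself
    -- would violate the condition.
    violation-at : ∀ {m} (V : Family m) i X J → Hall V → Violation (replace V i X) J → i FS.∈ J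
    violation-at V i X J hall violation with i FS.∈? J
    ... | yes i∈J = i∈J
    ... | no  i∉J = contradiction
      (ℕ.≤-trans violation (ℕ.+-monoˡ-≤ ∣ J ∣ (dim-mono (meet (replace V i X) J) (meet V J) meet≤)))
      (ℕ.≤⇒≯ (hall J))
      where
      meet≤ : meet (replace V i X) J ≤ₛ meet V J
      meet≤ {x} (x∈B , x∈V) = x∈B , λ j j∈J →
        ≡.subst (x ∈ₛ_) (replace-off V X λ { ≡.refl → i∉J j∈J }) (x∈V j j∈J)

    -- Submodularity: violations at J₁ and J₂ would add up to a violation of
    -- the original family at J₁ ∪ J₂ or at (J₁ ∩ J₂) - i.
    replace-hall : ∀ {m} (V : Family m) i X₁ X₂ → Hall V →
      carrier X₁ ∩ carrier X₂ ⊆ carrier (V i) →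
      Hall (replace V i X₁) ⊎ Hall (replace V i X₂)
    replace-hall V i X₁ X₂ hall X₁∩X₂⊆Vi
      with hall⊎violation (replace V i X₁) | hall⊎violation (replace V i X₂)
    ... | inj₁ hall₁ | _          = inj₁ hall₁
    ... | inj₂ _     | inj₁ hall₂ = inj₂ hall₂
    ... | inj₂ (J₁ , violation₁) | inj₂ (J₂ , violation₂) = contradiction bound (ℕ.<-irrefl ≡.refl)
      where
      M₁ = meet (replace V i X₁) J₁
      M₂ = meet (replace V i X₂) J₂
      i∈J₁ = violation-at V i X₁ J₁ hall violation₁
      i∈J₂ = violation-at V i X₂ J₂ hall violation₂
      J∪ = J₁ FS.∪ J₂
      J∩ = J₁ FS.∩ J₂
      at : ∀ {x X J} → i FS.∈ J → x ∈ₛ meet (replace V i X) J → x ∈ₛ X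
      at {x} {X} i∈J (_ , x∈V) = ≡.subst (x ∈ₛ_) (replace-at V i X) (x∈V i i∈J)
      off : ∀ {x X J j} → j ≢ i → j FS.∈ J → x ∈ₛ meet (replace V i X) J → x ∈ₛ V j
      off {x} {X} j≢i j∈J (_ , x∈V) = ≡.subst (x ∈ₛ_) (replace-off V X j≢i) (x∈V _ j∈J)
      ⊓≤ : M₁ ⊓ M₂ ≤ₛ meet V J∪
      ⊓≤ {x} (x∈M₁ , x∈M₂) = proj₁ x∈M₁ , λ j j∈J → in-V j (FS.x∈p∪q⁻ J₁ J₂ j∈J)
        where
        in-V : ∀ j → j FS.∈ J₁ ⊎ j FS.∈ J₂ → x ∈ₛ V j
        in-V j j∈J with j Fin.≟ i | j∈J
        ... | yes ≡.refl | _          = X₁∩X₂⊆Vi (at {X = X₁} {J₁} i∈J₁ x∈M₁ , at {X = X₂} {J₂} i∈J₂ x∈M₂)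
        ... | no j≢i     | inj₁ j∈J₁ = off {X = X₁} {J₁} j≢i j∈J₁ x∈M₁
        ... | no j≢i     | inj₂ j∈J₂ = off {X = X₂} {J₂} j≢i j∈J₂ x∈M₂
      ⊔≤ : M₁ ⊔ₛ M₂ ≤ₛ meet V (J∩ FS.- i)
      ⊔≤ = ⊞-least (isSubspace (meet V (J∩ FS.- i)))
        (λ x∈M₁ → proj₁ x∈M₁ , λ j j∈ → off {X = X₁} {J₁} (j∈p-i⇒j≢i J∩ j∈) (proj₁ (split j∈)) x∈M₁)
        (λ x∈M₂ → proj₁ x∈M₂ , λ j j∈ → off {X = X₂} {J₂} (j∈p-i⇒j≢i J∩ j∈) (proj₂ (split j∈)) x∈M₂)
        where
        split : ∀ {j} → j FS.∈ J∩ FS.- i → j FS.∈ J₁ × j FS.∈ J₂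
        split j∈ = FS.x∈p∩q⁻ J₁ J₂ (FS.p─q⊆p J∩ _ j∈)
      -- Two strict violations exceed twice `dim B` by two, while deleting `i` from `J∩` costs only
      -- one. The remaining one contradicts Hall's condition at `J∪` and `J∩ FS.- i`.
      bound : ℕ.suc (dim B ℕ.+ dim B) ℕ.< ℕ.suc (dim B ℕ.+ dim B)
      bound = begin
        ℕ.suc (ℕ.suc (dim B ℕ.+ dim B))
          ≡⟨ ≡.cong ℕ.suc (ℕ.+-suc (dim B) (dim B)) ⟨
        ℕ.suc (dim B) ℕ.+ ℕ.suc (dim B)
          ≤⟨ ℕ.+-mono-≤ violation₁ violation₂ ⟩
        (dim M₁ ℕ.+ ∣ J₁ ∣) ℕ.+ (dim M₂ ℕ.+ ∣ J₂ ∣)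
          ≡⟨ interchange (dim M₁) (∣ J₁ ∣) (dim M₂) (∣ J₂ ∣) ⟩
        (dim M₁ ℕ.+ dim M₂) ℕ.+ (∣ J₁ ∣ ℕ.+ ∣ J₂ ∣)
          ≡⟨ ≡.cong₂ ℕ._+_ (dim-⊔-⊓ M₁ M₂) (∣p∪q∣+∣p∩q∣≡∣p∣+∣q∣ J₁ J₂) ⟨
        (dim (M₁ ⊔ₛ M₂) ℕ.+ dim (M₁ ⊓ M₂)) ℕ.+ (∣ J∪ ∣ ℕ.+ ∣ J∩ ∣)
          ≤⟨ ℕ.+-mono-≤
               (ℕ.+-mono-≤ (dim-mono (M₁ ⊔ₛ M₂) (meet V (J∩ FS.- i)) ⊔≤)
                           (dim-mono (M₁ ⊓ M₂) (meet V J∪) ⊓≤))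
               (ℕ.+-monoʳ-≤ ∣ J∪ ∣ (∣p∣≤1+∣p-i∣ J∩ i)) ⟩
        (dim (meet V (J∩ FS.- i)) ℕ.+ dim (meet V J∪)) ℕ.+ (∣ J∪ ∣ ℕ.+ ℕ.suc ∣ J∩ FS.- i ∣)
          ≡⟨ rearrange (dim (meet V (J∩ FS.- i))) (dim (meet V J∪)) (∣ J∪ ∣) (∣ J∩ FS.- i ∣) ⟩
        ℕ.suc ((dim (meet V J∪) ℕ.+ ∣ J∪ ∣) ℕ.+ (dim (meet V (J∩ FS.- i)) ℕ.+ ∣ J∩ FS.- i ∣))
          ≤⟨ s≤s (ℕ.+-mono-≤ (hall J∪) (hall (J∩ FS.- i))) ⟩
        ℕ.suc (dim B ℕ.+ dim B) ∎
        where
        open ℕ.≤-Reasoning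
        interchange : ∀ a b c d → (a ℕ.+ b) ℕ.+ (c ℕ.+ d) ≡ (a ℕ.+ c) ℕ.+ (b ℕ.+ d)
        interchange = solve-∀
        rearrange : ∀ a b c d → (a ℕ.+ b) ℕ.+ (c ℕ.+ ℕ.suc d) ≡ ℕ.suc ((b ℕ.+ c) ℕ.+ (a ℕ.+ d))
        rearrange = solve-∀

    Admissible : ∀ {m} → Family m → Set (c ⊔ ℓ)
    Admissible V = (∀ j → V j ≤ₛ B) × Hall V

    replace-upper : ∀ {m} (V : Family m) i X → V i ≤ₛ X → V ≤ᶠ replace V i X
    replace-upper V i X Vi≤X j {x} x∈Vj with j Fin.≟ i
    ... | yes ≡.refl = ≡.subst (x ∈ₛ_) (≡.sym (replace-at V i X)) (Vi≤X x∈Vj)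
    ... | no  j≢i    = ≡.subst (x ∈ₛ_) (≡.sym (replace-off V X j≢i)) x∈Vj

    replace≤B : ∀ {m} (V : Family m) i X → (∀ j → V j ≤ₛ B) → X ≤ₛ B → ∀ j → replace V i X j ≤ₛ B
    replace≤B V i X V≤B X≤B j {x} x∈ with j Fin.≟ i
    ... | yes ≡.refl = X≤B (≡.subst (x ∈ₛ_) (replace-at V i X) x∈)
    ... | no  j≢i    = V≤B j (≡.subst (x ∈ₛ_) (replace-off V X j≢i) x∈)

    outside-vector : ∀ X → dim X ℕ.< dim B → ∃[ x ] x ∈ₛ B × x ∉ₛ X
    outside-vector X dimX<dimB with dec {∃[ x ] x ∈ₛ B × x ∉ₛ X}
    ... | yes witness = witness
    ... | no  none    = contradiction (dim-mono B X (⊆-stable none)) (ℕ.<⇒≱ dimX<dimB)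

    -- Codimension at least two leaves room for `x` and `y` independent modulo `V i`. The two
    -- one-step extensions then intersect in `V i`, so by `replace-hall` one of them preserves
    -- Hall's condition.
    enlarge : ∀ {m} (V : Family m) i → Admissible V → ℕ.suc (dim (V i)) ℕ.< dim B →
      ∃[ H ] Admissible H × V ≤ᶠ H × dim (V i) ℕ.< dim (H i)
    enlarge V i (V≤B , hall) small with outside-vector (V i) (ℕ.<-trans (ℕ.n<1+n _) small)
    ... | x , x∈B , x∉Vi with outside-vector (adjoin (V i) x∉Vi) small
    ... | y , y∈B , y∉X₁ = choose (replace-hall V i X₁ X₂ hall X₁∩X₂⊆Vi)
      where
      y∉Vi : y ∉ₛ V i
      y∉Vi = y∉X₁ ∘ adjoin-upper (V i) x∉Vi
      X₁ = adjoin (V i) x∉Vi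
      X₂ = adjoin (V i) y∉Vi
      X₁∩X₂⊆Vi : carrier X₁ ∩ carrier X₂ ⊆ carrier (V i)
      X₁∩X₂⊆Vi (z∈X₁ , (p , q , p∈Vi , (k , k∈K , q≈ky) , z≈p+q)) =
        FinSubspace.resp (V i) (sym z≈p) p∈Vi
        where
        k≈0 = FinSubspace.coefficient≈0 X₁ k∈K y∉X₁ (adjoin-upper (V i) x∉Vi p∈Vi) z∈X₁
          (trans z≈p+q (trans (+-congˡ q≈ky) (+-comm _ _)))
        z≈p = trans z≈p+q (trans (+-congˡ (trans q≈ky (trans (*-congʳ k≈0) (zeroˡ y)))) (+-identityʳ p))
      result : ∀ {z} (z∉Vi : z ∉ₛ V i) → z ∈ₛ B → Hall (replace V i (adjoin (V i) z∉Vi)) →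
        ∃[ H ] Admissible H × V ≤ᶠ H × dim (V i) ℕ.< dim (H i)
      result z∉Vi z∈B hall′ = replace V i X ,
        (replace≤B V i X V≤B (adjoin-least (V i) z∉Vi (isSubspace B) (V≤B i) z∈B) , hall′) ,
        replace-upper V i X (adjoin-upper (V i) z∉Vi) ,
        ℕ.≤-reflexive (≡.cong dim (≡.sym (replace-at V i X)))
        where X = adjoin (V i) z∉Vi
      choose : Hall (replace V i X₁) ⊎ Hall (replace V i X₂) →
        ∃[ H ] Admissible H × V ≤ᶠ H × dim (V i) ℕ.< dim (H i)
      choose (inj₁ hall₁) = result x∉Vi x∈B hall₁
      choose (inj₂ hall₂) = result y∉Vi y∈B hall₂

    enlarge-to-hyperplane : ∀ {m} (V : Family m) i → Admissible V →
      ∃[ H ] Admissible H × V ≤ᶠ H × dim B ℕ.≤ ℕ.suc (dim (H i))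
    enlarge-to-hyperplane V i admissible = go (dim B) V admissible (ℕ.m≤m+n (dim B) _)
      where
      go : ∀ fuel V → Admissible V → dim B ℕ.≤ fuel ℕ.+ dim (V i) →
        ∃[ H ] Admissible H × V ≤ᶠ H × dim B ℕ.≤ ℕ.suc (dim (H i))
      go fuel V admissible dimB≤ with dim B ℕ.≤? ℕ.suc (dim (V i))
      ... | yes codim≤1 = V , admissible , (λ _ → id) , codim≤1
      go zero V admissible dimB≤ | no codim≰1 = contradiction (ℕ.m≤n⇒m≤1+n dimB≤) codim≰1
      go (ℕ.suc fuel) V admissible dimB≤ | no codim≰1
        with enlarge V i admissible (ℕ.≰⇒> codim≰1)
      ... | H , H-admissible , V≤H , Vi<Hi
        with go fuel H H-admissible (ℕ.≤-trans dimB≤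
               (ℕ.≤-trans (ℕ.≤-reflexive (≡.sym (ℕ.+-suc fuel _))) (ℕ.+-monoʳ-≤ fuel Vi<Hi)))
      ... | H′ , H′-admissible , H≤H′ , codim≤1 =
        H′ , H′-admissible , (λ j → H≤H′ j ∘ V≤H j) , codim≤1

    abstract
      -- Members only grow, so the bound reached for one index survives the treatment of the others.
      -- Codimension zero is excluded by Hall's condition at a single index, so the `H i` are true
      -- hyperplanes.
      enlarge-to-hyperplanes : ∀ {m} (V : Family m) → Admissible V →
        ∃[ H ] Admissible H × V ≤ᶠ H × (∀ i → dim B ℕ.≤ ℕ.suc (dim (H i)))
      enlarge-to-hyperplanes {m} V admissible with go (List.allFin m)
        where
        go : (is : List (Fin m)) → ∃[ H ] Admissible H × V ≤ᶠ H × All (λ i → dim B ℕ.≤ ℕ.suc (dim (H i))) is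
        go List.[] = V , admissible , (λ _ → id) , All.[]
        go (i List.∷ is) with go is
        ... | H , H-admissible , V≤H , codim≤1 with enlarge-to-hyperplane H i H-admissible
        ... | H′ , H′-admissible , H≤H′ , codim≤1ᵢ =
          H′ , H′-admissible , (λ j → H≤H′ j ∘ V≤H j) ,
          codim≤1ᵢ All.∷ All.map
            (λ {j} codim≤1ⱼ → ℕ.≤-trans codim≤1ⱼ (s≤s (dim-mono (H j) (H′ j) (H≤H′ j)))) codim≤1
      ... | H , H-admissible , V≤H , codim≤1 =
        H , H-admissible , V≤H , λ i → All.lookup codim≤1 (∈-allFin i)

    -- Each hyperplane costs at most one dimension: `H zero ⊔ₛ T` stays inside `B`, and Grassmann's
    -- formula turns this into a lower bound for the intersection.
    dim-meet-hyperplanes : ∀ {m} (H : Family m) → (∀ i → H i ≤ₛ B) →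
      (∀ i → dim B ℕ.≤ ℕ.suc (dim (H i))) → dim B ℕ.≤ m ℕ.+ dim (meet H FS.⊤)
    dim-meet-hyperplanes {zero} H H≤B codim≤1 = dim-mono B (meet H FS.⊤) (λ x∈B → x∈B , λ ())
    dim-meet-hyperplanes {ℕ.suc m} H H≤B codim≤1 = ℕ.+-cancelˡ-≤ (dim B) _ _ (begin
      dim B ℕ.+ dim B
        ≤⟨ ℕ.+-mono-≤ (codim≤1 zero) (dim-meet-hyperplanes (H ∘ Fin.suc) (H≤B ∘ Fin.suc) (codim≤1 ∘ Fin.suc)) ⟩
      ℕ.suc (dim (H zero)) ℕ.+ (m ℕ.+ dim T)
        ≡⟨ rearrange (dim (H zero)) m (dim T) ⟩
      ℕ.suc m ℕ.+ (dim (H zero) ℕ.+ dim T)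
        ≡⟨ ≡.cong (ℕ.suc m ℕ.+_) (dim-⊔-⊓ (H zero) T) ⟨
      ℕ.suc m ℕ.+ (dim (H zero ⊔ₛ T) ℕ.+ dim (H zero ⊓ T))
        ≤⟨ ℕ.+-monoʳ-≤ (ℕ.suc m) (ℕ.+-mono-≤
             (dim-mono (H zero ⊔ₛ T) B (⊞-least (isSubspace B) (H≤B zero) proj₁))
             (dim-mono (H zero ⊓ T) (meet H FS.⊤) ⊓≤)) ⟩
      ℕ.suc m ℕ.+ (dim B ℕ.+ dim (meet H FS.⊤))
        ≡⟨ rearrange′ (ℕ.suc m) (dim B) (dim (meet H FS.⊤)) ⟩
      dim B ℕ.+ (ℕ.suc m ℕ.+ dim (meet H FS.⊤)) ∎)
      where
      open ℕ.≤-Reasoning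
      T = meet (H ∘ Fin.suc) FS.⊤
      ⊓≤ : H zero ⊓ T ≤ₛ meet H FS.⊤
      ⊓≤ (x∈H₀ , x∈B , x∈H) = x∈B , λ { zero _ → x∈H₀ ; (Fin.suc i) _ → x∈H i FS.∈⊤ }
      rearrange : ∀ a b c → ℕ.suc a ℕ.+ (b ℕ.+ c) ≡ ℕ.suc b ℕ.+ (a ℕ.+ c)
      rearrange = solve-∀
      rearrange′ : ∀ a b c → a ℕ.+ (b ℕ.+ c) ≡ b ℕ.+ (a ℕ.+ c)
      rearrange′ = solve-∀

    independent⇒basis : ∀ (v : Vector Carrier (dim B)) → (∀ i → v i ∈ₛ B) →
      LinearlyIndependent v → IsBasis (carrier B) v
    independent⇒basis v v∈B ind = record
      { members     = v∈B
      ; independent = ind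
      ; spanning    = LinSpan⊆Span v ∘ dim-equal V B V≤B ℕ.≤-refl
      }
      where
      V : FinSubspace
      V = linSpan v ind
      V≤B : V ≤ₛ B
      V≤B = Subspace.Span⊆ (isSubspace B) (Range⊆ (isSubspace B) v∈B) ∘ LinSpan⊆Span v

    abstract
      -- All hyperplanes but the i-th still share a nonzero vector, by counting; it serves as `b i`.
      -- It cannot lie in `H i` as well, because Hall's condition at the full index set makes the
      -- common intersection zero. The equation `m ≡ dim B` keeps `m` a variable on which to split.
      dual-basis : ∀ {m} (H : Family m) → m ≡ dim B → Admissible H →
        (∀ i → dim B ℕ.≤ ℕ.suc (dim (H i))) →
        ∃ λ (b : Vector Carrier m) → (∀ i → b i ∈ₛ B) × (∀ i → b i ∉ₛ H i) × (∀ i j → j ≢ i → b j ∈ₛ H i)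
      dual-basis {zero}    H m≡dimB admissible codim≤1 = [] , (λ ()) , (λ ()) , (λ ())
      dual-basis {ℕ.suc m} H m≡dimB (H≤B , hall) codim≤1 =
        (λ i → proj₁ (pick i)) , (λ i → proj₁ (b∈others i)) , b∉H , b∈H
        where
        others : Fin (ℕ.suc m) → FinSubspace
        others i = meet (H ∘ punchIn i) FS.⊤
        1≤others : ∀ i → 1 ℕ.≤ dim (others i)
        1≤others i = ℕ.+-cancelˡ-≤ m _ _ (ℕ.≤-trans
          (ℕ.≤-reflexive (≡.trans (ℕ.+-comm m 1) m≡dimB))
          (dim-meet-hyperplanes (H ∘ punchIn i) (H≤B ∘ punchIn i) (codim≤1 ∘ punchIn i)))
        pick : ∀ i → ∃[ x ] x ∈ₛ others i × ¬ x ≈ 0#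
        pick i = 1≤dim⇒nonzero (others i) (1≤others i)
        b∈others : ∀ i → proj₁ (pick i) ∈ₛ others i
        b∈others i = proj₁ (proj₂ (pick i))
        b∈H : ∀ i j → j ≢ i → proj₁ (pick j) ∈ₛ H i
        b∈H i j j≢i = ≡.subst (λ i → proj₁ (pick j) ∈ₛ H i) (Fin.punchIn-punchOut j≢i)
          (proj₂ (b∈others j) (punchOut j≢i) FS.∈⊤)
        b∉H : ∀ i → proj₁ (pick i) ∉ₛ H i
        b∉H i b∈Hi = ℕ.<⇒≱ (ℕ.+-monoˡ-≤ ∣ FS.⊤ {ℕ.suc m} ∣
            (nonzero⇒1≤dim (meet H FS.⊤) (proj₁ (b∈others i) , in-all) (proj₂ (proj₂ (pick i)))))
          (ℕ.≤-trans (hall FS.⊤) (ℕ.≤-reflexive (≡.trans (≡.sym m≡dimB) (≡.sym (FS.∣⊤∣≡n (ℕ.suc m))))))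
          where
          in-all : ∀ j → j FS.∈ FS.⊤ → proj₁ (pick i) ∈ₛ H j
          in-all j _ with j Fin.≟ i
          ... | yes ≡.refl = b∈Hi
          ... | no  j≢i    = b∈H j i (j≢i ∘ ≡.sym)

    -- Modulo `H` only the i-th term of the combination survives. Taking `x` to be zero yields
    -- independence of `b`; a general `x` yields the inclusion of `H` in the span of the other
    -- vectors.
    hyperplane-coefficient≈0 : ∀ {m} (H : FinSubspace) (b : Vector Carrier m) i → b i ∉ₛ H →
      (∀ j → j ≢ i → b j ∈ₛ H) → ∀ {x} k → (∀ j → k j ∈ K) → x ∈ₛ H → x ≈ combination k b →
      k i ≈ 0# × x ∈ Span (RangeExcept b i)
    hyperplane-coefficient≈0 {ℕ.suc m} H b i bi∉H b∈H {x} k k∈K x∈H x≈ = ki≈0 ,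
      (m , k ∘ punchIn i , b ∘ punchIn i , k∈K ∘ punchIn i ,
       (λ j → punchIn i j , Fin.punchInᵢ≢i i j , refl) ,
       trans x≈ki+rest (trans (+-congʳ (trans (*-congʳ ki≈0) (zeroˡ _))) (+-identityˡ _)))
      where
      rest : Carrier
      rest = combination (k ∘ punchIn i) (b ∘ punchIn i)
      x≈ki+rest : x ≈ k i * b i + rest
      x≈ki+rest = trans x≈ (sum-remove {i = i} (λ j → k j * b j))
      ki≈0 : k i ≈ 0#
      ki≈0 = FinSubspace.coefficient≈0 H (k∈K i) bi∉H
        (FinSubspace.combination-closed H (k∈K ∘ punchIn i) (λ j → b∈H _ (Fin.punchInᵢ≢i i j)))
        x∈H x≈ki+rest

    dual⇒basis : (H : Family (dim B)) (b : Vector Carrier (dim B)) →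
      (∀ i → b i ∈ₛ B) → (∀ i → b i ∉ₛ H i) → (∀ i j → j ≢ i → b j ∈ₛ H i) → IsBasis (carrier B) b
    dual⇒basis H b b∈B b∉H b∈H = independent⇒basis b b∈B λ k k∈K eq i →
      proj₁ (hyperplane-coefficient≈0 (H i) b i (b∉H i) (b∈H i) k k∈K (FinSubspace.0∈ (H i)) (sym eq))

    hyperplane⊆Span : ∀ {m} (H : FinSubspace) (b : Vector Carrier m) i → b i ∉ₛ H →
      (∀ j → j ≢ i → b j ∈ₛ H) → ∀ {x} → x ∈ₛ H → x ∈ LinSpan b → x ∈ Span (RangeExcept b i)
    hyperplane⊆Span H b i bi∉H b∈H x∈H (k , k∈K , x≈) =
      proj₂ (hyperplane-coefficient≈0 H b i bi∉H b∈H k k∈K x∈H x≈)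

    hall⇒basis : (V : Family (dim B)) → Admissible V →
      ∃ λ (b : Vector Carrier (dim B)) → IsBasis (carrier B) b × (∀ i → carrier (V i) ⊆ Span (RangeExcept b i))
    hall⇒basis V admissible =
      let (H , H-admissible , V≤H , codim≤1) = enlarge-to-hyperplanes V admissible
          (b , b∈B , b∉H , b∈H) = dual-basis H ≡.refl H-admissible codim≤1
          basis = dual⇒basis H b b∈B b∉H b∈H
      in b , basis , λ i x∈Vi → hyperplane⊆Span (H i) b i (b∉H i) (b∈H i) (V≤H i x∈Vi)
           (Span⊆LinSpan b (IsBasis.spanning basis (proj₁ H-admissible i (V≤H i x∈Vi))))

  -- The selected vectors are adjoined one at a time to a subspace `Z` of `X`. Keeping `Z` inside
  -- the span of the later vectors ensures that the next one is new.
  independent⇒∣J∣≤dim : ∀ {n} (v : Vector Carrier n) → LinearlyIndependent v → ∀ J (X : FinSubspace) →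
    (∀ j → j FS.∈ J → v j ∈ₛ X) → ∣ J ∣ ℕ.≤ dim X
  independent⇒∣J∣≤dim v ind J X v∈X with go v ind J v∈X
    where
    go : ∀ {n} (v : Vector Carrier n) → LinearlyIndependent v → ∀ J →
      (∀ j → j FS.∈ J → v j ∈ₛ X) → ∃[ Z ] dim Z ≡ ∣ J ∣ × Z ≤ₛ X × carrier Z ⊆ LinSpan v
    go v ind Vec.[] v∈X = zeroSpace , ≡.refl , zeroSpace-least (isSubspace X) , λ { (_ , _ , x≈0) → (λ ()) , (λ ()) , x≈0 }
    go v ind (side Vec.∷ J) v∈X with go (tail v) tail-ind J (λ j j∈J → v∈X (Fin.suc j) (Vec.there j∈J))
      where
      tail-ind : LinearlyIndependent (tail v)
      tail-ind k k∈K eq i = ind (0# ∷ k) (∷∈K K.0∈ k∈K)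
        (trans (+-cong (zeroˡ _) eq) (+-identityˡ 0#)) (Fin.suc i)
    go {ℕ.suc n} v ind (side Vec.∷ J) v∈X | Z , dimZ , Z≤X , Z⊆ = extend side v∈X
      where
      widen : LinSpan (tail v) ⊆ LinSpan v
      widen (k , k∈K , x≈) = 0# ∷ k , ∷∈K K.0∈ k∈K , trans x≈ (sym (trans (+-congʳ (zeroˡ _)) (+-identityˡ _)))
      v₀∉Z : v zero ∉ₛ Z
      v₀∉Z v₀∈Z with Z⊆ v₀∈Z
      ... | k , k∈K , v₀≈ = 1≉0 (ind (1# ∷ (λ i → - 1# * k i))
        (∷∈K K.1∈ (λ i → K.*-closed (K.-‿closed K.1∈) (k∈K i)))
        (trans (+-cong (trans (*-identityˡ _) v₀≈) (trans (combination-* (- 1#) k (tail v)) (-1*x≈-x _)))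
          (-‿inverseʳ _))
        zero)
      extend : ∀ side → (∀ j → j FS.∈ side Vec.∷ J → v j ∈ₛ X) →
        ∃[ Z ] dim Z ≡ ∣ side Vec.∷ J ∣ × Z ≤ₛ X × carrier Z ⊆ LinSpan v
      extend outside v∈X = Z , dimZ , Z≤X , widen ∘ Z⊆
      extend inside  v∈X = adjoin Z v₀∉Z , ≡.cong ℕ.suc dimZ ,
        adjoin-least Z v₀∉Z (isSubspace X) Z≤X (v∈X zero Vec.here) ,
        adjoin-least Z v₀∉Z (LinSpan-isSubspace v) (widen ∘ Z⊆) (member∈LinSpan v zero)
  ... | Z , dimZ , Z≤X , _ = ℕ.≤-trans (ℕ.≤-reflexive (≡.sym dimZ)) (dim-mono Z X Z≤X)

  -- Stable subspaces and atoms

  Stable : FinSubspace → FinSubspace → Set (c ⊔ ℓ)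
  Stable W X = ∀ {x w} → x ∈ₛ X → w ∈ₛ W → x * w ∈ₛ X

  abstract
    -- Dyson's e-transform (S , W) ↦ (S + eW , W ∩ e⁻¹S) preserves dim S + dim W
    -- and keeps SW inside A, so it stops at a pair with SW ⊆ S.
    e-transform : ∀ A S W → 1# ∈ₛ W → (∀ {x w} → x ∈ₛ S → w ∈ₛ W → x * w ∈ₛ A) →
      ∃[ S′ ] ∃[ W′ ] 1# ∈ₛ W′ × W′ ≤ₛ W × S′ ≤ₛ A × Stable W′ S′ ×
        dim S ℕ.+ dim W ℕ.≤ dim S′ ℕ.+ dim W′
    e-transform A S W = go (dim A) S W (ℕ.m≤m+n (dim A) (dim S))
      where
      go : ∀ fuel S W → dim A ℕ.≤ fuel ℕ.+ dim S → 1# ∈ₛ W → (∀ {x w} → x ∈ₛ S → w ∈ₛ W → x * w ∈ₛ A) →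
        ∃[ S′ ] ∃[ W′ ] 1# ∈ₛ W′ × W′ ≤ₛ W × S′ ≤ₛ A × Stable W′ S′ ×
          dim S ℕ.+ dim W ℕ.≤ dim S′ ℕ.+ dim W′
      go fuel S W dimA≤ 1∈W SW⊆A with dec {∃[ e ] ∃[ w ] e ∈ₛ S × w ∈ₛ W × e * w ∉ₛ S}
      ... | no none = S , W , 1∈W , id ,
        (λ x∈S → FinSubspace.resp A (*-identityʳ _) (SW⊆A x∈S 1∈W)) ,
        (λ {x} {w} x∈S w∈W → decidable-stable dec (λ xw∉S → none (x , w , x∈S , w∈W , xw∉S))) ,
        ℕ.≤-refl
      ... | yes (e , w₀ , e∈S , w₀∈W , ew₀∉S) = continue fuel dimA≤
        where
        e≉0 : ¬ e ≈ 0#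
        e≉0 e≈0 = ew₀∉S (FinSubspace.resp S (sym (trans (*-congʳ e≈0) (zeroˡ w₀))) (FinSubspace.0∈ S))
        S₁ : FinSubspace
        S₁ = S ⊔ₛ scale e≉0 W
        W₁ : FinSubspace
        W₁ = restrict {X = λ w → w ∈ₛ W × e * w ∈ₛ S} (record
          { resp     = λ { x≈y (x∈W , ex∈S) → FinSubspace.resp W x≈y x∈W , FinSubspace.resp S (*-congˡ x≈y) ex∈S }
          ; 0∈       = FinSubspace.0∈ W , FinSubspace.resp S (sym (zeroʳ e)) (FinSubspace.0∈ S)
          ; +-closed = λ { (x∈W , ex∈S) (y∈W , ey∈S) → FinSubspace.+-closed W x∈W y∈W ,
              FinSubspace.resp S (sym (distribˡ e _ _)) (FinSubspace.+-closed S ex∈S ey∈S) }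
          ; ·-closed = λ { {k} {x} k∈K (x∈W , ex∈S) → FinSubspace.·-closed W k∈K x∈W ,
              FinSubspace.resp S (solve 3 (λ k e x → k :* (e :* x) := e :* (k :* x)) refl k e x)
                (FinSubspace.·-closed S k∈K ex∈S) }
          }) W proj₁
        1∈W₁ : 1# ∈ₛ W₁
        1∈W₁ = 1∈W , FinSubspace.resp S (sym (*-identityʳ e)) e∈S
        -- This rests on (s + eu)w = sw + (ew)u, where ew lies in `S` by the choice of `W₁`;
        -- commutativity enters here.
        S₁W₁⊆A : ∀ {x w} → x ∈ₛ S₁ → w ∈ₛ W₁ → x * w ∈ₛ A
        S₁W₁⊆A {x} {w} (s , t , s∈S , (u , u∈W , t≈eu) , x≈s+t) (w∈W , ew∈S) =
          FinSubspace.resp A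
            (sym (trans (*-congʳ (trans x≈s+t (+-congˡ t≈eu)))
              (solve 4 (λ s e u w → (s :+ e :* u) :* w := s :* w :+ (e :* w) :* u) refl s e u w)))
            (FinSubspace.+-closed A (SW⊆A s∈S w∈W) (SW⊆A ew∈S u∈W))
        -- The product of `e` and `w₀` was chosen outside `S`. This strict growth inside `A` is what
        -- ends the iteration.
        S<S₁ : dim S ℕ.< dim S₁
        S<S₁ = dim-mono (adjoin S ew₀∉S) S₁
          (adjoin-least S ew₀∉S (isSubspace S₁) (⊞-upperˡ (isSubspace (scale e≉0 W)))
            (⊞-upperʳ (isSubspace S) (w₀ , w₀∈W , refl)))
        sum≤ : dim S ℕ.+ dim W ℕ.≤ dim S₁ ℕ.+ dim W₁
        sum≤ = ℕ.≤-trans (ℕ.≤-reflexive (≡.sym (dim-⊔-⊓ S (scale e≉0 W))))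
          (ℕ.+-monoʳ-≤ (dim S₁) (dim-mono (S ⊓ scale e≉0 W) (scale e≉0 W₁)
            λ { (x∈S , (w , w∈W , x≈ew)) → w , (w∈W , FinSubspace.resp S x≈ew x∈S) , x≈ew }))
        continue : ∀ fuel → dim A ℕ.≤ fuel ℕ.+ dim S →
          ∃[ S′ ] ∃[ W′ ] 1# ∈ₛ W′ × W′ ≤ₛ W × S′ ≤ₛ A × Stable W′ S′ ×
            dim S ℕ.+ dim W ℕ.≤ dim S′ ℕ.+ dim W′
        continue zero dimA≤ = contradiction (dim-mono S₁ A S₁≤A) (ℕ.<⇒≱ (ℕ.≤-<-trans dimA≤ S<S₁))
          where
          S₁≤A : S₁ ≤ₛ A
          S₁≤A x∈S₁ = FinSubspace.resp A (*-identityʳ _) (S₁W₁⊆A x∈S₁ 1∈W₁)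
        continue (ℕ.suc fuel) dimA≤ =
          let (S′ , W′ , 1∈W′ , W′≤W₁ , S′≤A , stable , sum≤′) =
                go fuel S₁ W₁
                  (ℕ.≤-trans dimA≤ (ℕ.≤-trans (ℕ.≤-reflexive (≡.sym (ℕ.+-suc fuel (dim S)))) (ℕ.+-monoʳ-≤ fuel S<S₁)))
                  1∈W₁ S₁W₁⊆A
          in S′ , W′ , 1∈W′ , proj₁ ∘ W′≤W₁ , S′≤A , stable , ℕ.≤-trans sum≤ sum≤′

  Nonzero : FinSubspace → Set (c ⊔ ℓ)
  Nonzero X = ∃[ x ] x ∈ₛ X × ¬ x ≈ 0#

  module Atom (W : FinSubspace) (1∈W : 1# ∈ₛ W) where

    Minimal : FinSubspace → Set (suc (c ⊔ ℓ))
    Minimal X = ∀ Y → Nonzero Y → Stable W Y → dim X ℕ.≤ dim Y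

    scale-stable : ∀ {e} (e≉0 : ¬ e ≈ 0#) X → Stable W X → Stable W (scale e≉0 X)
    scale-stable e≉0 X stable {w = w} (x , x∈X , y≈ex) w∈W =
      x * w , stable x∈X w∈W , trans (*-congʳ y≈ex) (*-assoc _ x w)

    minimal-stable : ∀ X → Nonzero X → Stable W X →
      ∃[ Y ] Nonzero Y × Stable W Y × Minimal Y × dim Y ℕ.≤ dim X
    minimal-stable X = go (dim X) X ℕ.≤-refl
      where
      go : ∀ fuel X → dim X ℕ.≤ fuel → Nonzero X → Stable W X →
        ∃[ Y ] Nonzero Y × Stable W Y × Minimal Y × dim Y ℕ.≤ dim X
      go fuel X dimX≤ X≠0 stable with em {∃[ Y ] Nonzero Y × Stable W Y × dim Y ℕ.< dim X}
      ... | no none = X , X≠0 , stable ,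
        (λ Y Y≠0 Y-stable → ℕ.≮⇒≥ (λ dimY<dimX → none (Y , Y≠0 , Y-stable , dimY<dimX))) , ℕ.≤-refl
      go zero X dimX≤ X≠0 stable | yes (Y , Y≠0 , Y-stable , dimY<dimX) =
        contradiction (ℕ.<-≤-trans dimY<dimX dimX≤) ℕ.n≮0
      go (ℕ.suc fuel) X dimX≤ X≠0 stable | yes (Y , Y≠0 , Y-stable , dimY<dimX) =
        let (Z , Z≠0 , Z-stable , minimal , dimZ≤) = go fuel Y (ℕ.s≤s⁻¹ (ℕ.<-≤-trans dimY<dimX dimX≤)) Y≠0 Y-stable
        in Z , Z≠0 , Z-stable , minimal , ℕ.≤-trans dimZ≤ (ℕ.<⇒≤ dimY<dimX)

    abstract
      minimal-stable∋1 : ∀ X → Nonzero X → Stable W X →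
        ∃[ M ] 1# ∈ₛ M × Stable W M × Minimal M × dim M ℕ.≤ dim X
      minimal-stable∋1 X X≠0 stable =
        let (Y , (y , y∈Y , y≉0) , Y-stable , minimal , dimY≤) = minimal-stable X X≠0 stable
            (y⁻¹ , y⁻¹y≈1) = inverse y≉0
            y⁻¹≉0 = λ y⁻¹≈0 → 1≉0 (trans (sym y⁻¹y≈1) (trans (*-congʳ y⁻¹≈0) (zeroˡ y)))
        -- Scaling keeps `dim` definitionally, so `minimal` and `dimY≤` apply to the translate
        -- unchanged.
        in scale y⁻¹≉0 Y , (y , y∈Y , sym y⁻¹y≈1) , scale-stable y⁻¹≉0 Y Y-stable , minimal , dimY≤

    module _ (M : FinSubspace) (1∈M : 1# ∈ₛ M) (stable : Stable W M) (minimal : Minimal M) where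

      -- M ∩ xM is stable and contains x, so minimality gives M = xM.
      M≤xM : ∀ {x} (x≉0 : ¬ x ≈ 0#) → x ∈ₛ M → M ≤ₛ scale x≉0 M
      M≤xM {x} x≉0 x∈M m∈M = proj₂ (dim-equal (M ⊓ scale x≉0 M) M proj₁
        (minimal (M ⊓ scale x≉0 M)
          (x , (x∈M , 1# , 1∈M , sym (*-identityʳ x)) , x≉0)
          (λ { (y∈M , y∈xM) w∈W → stable y∈M w∈W , scale-stable x≉0 M stable y∈xM w∈W })) m∈M)

      xM≤M : ∀ {x} (x≉0 : ¬ x ≈ 0#) → x ∈ₛ M → scale x≉0 M ≤ₛ M
      xM≤M x≉0 x∈M = dim-equal M (scale x≉0 M) (M≤xM x≉0 x∈M) ℕ.≤-refl

      minimal⇒subfield : IsSubfield L (carrier M)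
      minimal⇒subfield = record
        { resp      = M.resp
        ; 0∈        = M.0∈
        ; 1∈        = 1∈M
        ; +-closed  = M.+-closed
        ; -‿closed  = M.-‿closed
        ; *-closed  = *-closed
        ; ⁻¹-closed = ⁻¹-closed
        }
        where
        module M = FinSubspace M
        *-closed : ∀ {x y} → x ∈ₛ M → y ∈ₛ M → x * y ∈ₛ M
        *-closed {x} {y} x∈M y∈M with dec≈ x 0#
        ... | yes x≈0 = M.resp (sym (trans (*-congʳ x≈0) (zeroˡ y))) M.0∈
        ... | no  x≉0 = xM≤M x≉0 x∈M (y , y∈M , refl)
        ⁻¹-closed : ∀ {x y} → x ∈ₛ M → x * y ≈ 1# → y ∈ₛ M
        ⁻¹-closed {x} {y} x∈M xy≈1 = divide (M≤xM x≉0 x∈M 1∈M)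
          where
          open ≈-Reasoning
          x≉0 : ¬ x ≈ 0#
          x≉0 x≈0 = 1≉0 (trans (sym xy≈1) (trans (*-congʳ x≈0) (zeroˡ y)))
          divide : 1# ∈ₛ scale x≉0 M → y ∈ₛ M
          divide (m , m∈M , 1≈xm) = M.resp (begin
            m            ≈⟨ cancel-inverse m (trans (*-comm y x) xy≈1) ⟨
            y * (x * m)  ≈⟨ *-congˡ 1≈xm ⟨
            y * 1#       ≈⟨ *-identityʳ y ⟩
            y            ∎) m∈M

      -- Holds because 1 lies in `W`; it is the reason why ∂ never takes a negative value.
      X⊆⟨XW⟩ : ∀ {X} → X ⊆ ⟨ X · carrier W ⟩
      X⊆⟨XW⟩ {X} {x} x∈X = 1 , (λ _ → 1#) , (λ _ → x * 1#) , (λ _ → K.1∈) ,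
        (λ _ → x , 1# , x∈X , 1∈W , refl) ,
        sym (trans (+-identityʳ _) (trans (*-identityˡ _) (*-identityʳ x)))

      ⟨MW⟩⊆M : ⟨ carrier M · carrier W ⟩ ⊆ carrier M
      ⟨MW⟩⊆M = FinSubspace.Span⊆ M {S = Products (carrier M) (carrier W)} λ { (x , w , x∈M , w∈W , z≈xw) →
        FinSubspace.resp M (sym z≈xw) (stable x∈M w∈W) }

      ∂M : ∂ (carrier W) (carrier M) (ℤ.+ 0)
      ∂M = dim M , dim M , HasDimension-resp-≐ (X⊆⟨XW⟩ , ⟨MW⟩⊆M) (hasDimension M) , hasDimension M ,
        ≡.sym (ℤ.n⊖n≡0 (dim M))

      -- A fragment has ∂ ≤ ∂M = 0, so it equals its product with W.
      minimal⇒atom : ¬ Universal (carrier M) → IsAtom (carrier W) (carrier M)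
      minimal⇒atom M≢L = (ψM , ℤ.+ 0 , ((carrier M , ψM , ∂M) , λ X _ → 0≤∂) , ∂M) , least
        where
        ψM : ψ (carrier W) (carrier M)
        ψM = record
          { isSubspace        = isSubspace M
          ; nonzero           = 1# , 1∈M , 1≉0
          ; finiteDimensional = dim M , hasDimension M
          ; product≢L         = λ all → M≢L (λ x → ⟨MW⟩⊆M (all x))
          }
        0≤∂ : ∀ {X} d → ∂ (carrier W) X d → ℤ.+ 0 ℤ.≤ d
        0≤∂ _ (m , n , hm , hn , ≡.refl) =
          ≡.subst (ℤ.+ 0 ℤ.≤_) (≡.sym (ℤ.⊖-≥ (HasDimension-mono X⊆⟨XW⟩ hn hm))) (ℤ.+≤+ z≤n)
        m⊖n≤0⇒m≤n : ∀ m n → m ℤ.⊖ n ℤ.≤ ℤ.+ 0 → m ℕ.≤ n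
        m⊖n≤0⇒m≤n m n m⊖n≤0 with m ℕ.≤? n
        ... | yes m≤n = m≤n
        ... | no  m≰n = ℕ.m∸n≡0⇒m≤n (ℕ.n≤0⇒n≡0 (ℤ.drop‿+≤+
          (≡.subst (ℤ._≤ ℤ.+ 0) (ℤ.⊖-≥ (ℕ.<⇒≤ (ℕ.≰⇒> m≰n))) m⊖n≤0)))
        least : ∀ Y → IsFragment (carrier W) Y → ∀ m n →
          HasDimension (carrier M) m → HasDimension Y n → m ℕ.≤ n
        least Y (ψY , k , (_ , k≤) , (p , q , (v , v-basis) , hq , ≡.refl)) m n hm hn =
          ℕ.≤-trans (HasDimension-mono id hm (hasDimension M))
            (ℕ.≤-trans (minimal Yₛ (ψ.nonzero ψY) Y-stable) (HasDimension-mono id hq hn))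
          where
          Yₛ : FinSubspace
          Yₛ = record { isSubspace = ψ.isSubspace ψY ; hasDimension = hq }
          -- The product space enters only through its basis `v`, whose span is a `FinSubspace` and
          -- can be compared with `Yₛ` by dimension.
          YW : FinSubspace
          YW = linSpan v (IsBasis.independent v-basis)
          ⟨YW⟩⊆YW : ⟨ Y · carrier W ⟩ ⊆ carrier YW
          ⟨YW⟩⊆YW = Span⊆LinSpan v ∘ IsBasis.spanning v-basis
          Y-stable : Stable W Yₛ
          Y-stable {y} {w} y∈Y w∈W = dim-equal Yₛ YW (⟨YW⟩⊆YW ∘ X⊆⟨XW⟩)
            (m⊖n≤0⇒m≤n p q (k≤ (carrier M) ψM (ℤ.+ 0) ∂M))
            (⟨YW⟩⊆YW (1 , (λ _ → 1#) , (λ _ → y * w) , (λ _ → K.1∈) ,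
              (λ _ → y , w , y∈Y , w∈W , refl) , sym (trans (+-identityʳ _) (*-identityˡ _))))

  -- From an unmatched pair to an intermediate field

  module Unmatched (A B : FinSubspace) (dimA≡dimB : dim A ≡ dim B) where
    open Rado B

    -- This is a⁻¹A ∩ B, phrased by multiplying with `a` so that no inverse appears.
    quotient : Carrier → FinSubspace
    quotient a = restrict {X = λ x → x ∈ₛ B × a * x ∈ₛ A} (record
      { resp     = λ { x≈y (x∈B , ax∈A) → FinSubspace.resp B x≈y x∈B , FinSubspace.resp A (*-congˡ x≈y) ax∈A }
      ; 0∈       = FinSubspace.0∈ B , FinSubspace.resp A (sym (zeroʳ a)) (FinSubspace.0∈ A)
      ; +-closed = λ { (x∈B , ax∈A) (y∈B , ay∈A) → FinSubspace.+-closed B x∈B y∈B ,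
          FinSubspace.resp A (sym (distribˡ a _ _)) (FinSubspace.+-closed A ax∈A ay∈A) }
      ; ·-closed = λ { {k} {x} k∈K (x∈B , ax∈A) → FinSubspace.·-closed B k∈K x∈B ,
          FinSubspace.resp A (solve 3 (λ k a x → k :* (a :* x) := a :* (k :* x)) refl k a x)
            (FinSubspace.·-closed A k∈K ax∈A) }
      }) B proj₁

    quotients : Vector Carrier (dim B) → Family (dim B)
    quotients a i = quotient (a i)

    ⁻¹·∩⊆quotient : ∀ a → (a ⁻¹· carrier A) ∩ carrier B ⊆ carrier (quotient a)
    ⁻¹·∩⊆quotient a ((a⁻¹ , x , a⁻¹a≈1 , x∈A , y≈a⁻¹x) , y∈B) = y∈B , FinSubspace.resp A
      (sym (trans (*-congˡ y≈a⁻¹x) (cancel-inverse x (trans (*-comm a a⁻¹) a⁻¹a≈1)))) x∈A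

    -- Without a violation Hall's condition holds, and Rado's theorem would match every basis of
    -- `A`.
    unmatched⇒violation : ¬ Matched (dim B) (carrier A) (carrier B) →
      ∃ λ (a : Vector Carrier (dim B)) → IsBasis (carrier A) a × ∃ (Violation (quotients a))
    unmatched⇒violation unmatched = decidable-stable dec λ none → unmatched λ a a-basis →
      match a (λ violation → none (a , a-basis , violation))
      where
      match : ∀ a → ¬ ∃ (Violation (quotients a)) →
        ∃ λ (b : Vector Carrier (dim B)) → IsBasis (carrier B) b × BasisMatched (carrier A) (carrier B) a b
      match a none with hall⊎violation (quotients a)
      ... | inj₂ violation = contradiction violation none
      ... | inj₁ hall =
        let (b , b-basis , quotients⊆) = hall⇒basis (quotients a) ((λ _ → proj₁) , hall)
        in b , b-basis , λ i x∈ → quotients⊆ i (⁻¹·∩⊆quotient (a i) x∈)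

    module _ (1∉B : 1# ∉ₛ B) {a : Vector Carrier (dim B)} (a-basis : IsBasis (carrier A) a)
      (J : FS.Subset (dim B)) (violation : Violation (quotients a) J) where

      private
        T : FinSubspace
        T = meet (quotients a) J

        1∉T : 1# ∉ₛ T
        1∉T = 1∉B ∘ proj₁

        W₀ : FinSubspace
        W₀ = adjoin T 1∉T

        S₀ : FinSubspace
        S₀ = restrict {X = λ x → x ∈ₛ A × (∀ {t} → t ∈ₛ T → x * t ∈ₛ A)} (record
          { resp     = λ { x≈y (x∈A , xT⊆A) → A.resp x≈y x∈A , λ t∈T → A.resp (*-congʳ x≈y) (xT⊆A t∈T) }
          ; 0∈       = A.0∈ , λ _ → A.resp (sym (zeroˡ _)) A.0∈
          ; +-closed = λ { (x∈A , xT⊆A) (y∈A , yT⊆A) → A.+-closed x∈A y∈A ,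
              λ t∈T → A.resp (sym (distribʳ _ _ _)) (A.+-closed (xT⊆A t∈T) (yT⊆A t∈T)) }
          ; ·-closed = λ { k∈K (x∈A , xT⊆A) → A.·-closed k∈K x∈A ,
              λ t∈T → A.resp (sym (*-assoc _ _ _)) (A.·-closed k∈K (xT⊆A t∈T)) }
          }) A proj₁
          where module A = FinSubspace A

        S₀W₀⊆A : ∀ {x w} → x ∈ₛ S₀ → w ∈ₛ W₀ → x * w ∈ₛ A
        S₀W₀⊆A {x} (x∈A , xT⊆A) (t , l , t∈T , (k , k∈K , l≈k1) , w≈t+l) = A.resp
          (sym (trans (*-congˡ (trans w≈t+l (+-congˡ (trans l≈k1 (*-identityʳ k)))))
            (solve 3 (λ x t k → x :* (t :+ k) := x :* t :+ k :* x) refl x t k)))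
          (A.+-closed (xT⊆A t∈T) (A.·-closed k∈K x∈A))
          where module A = FinSubspace A

        -- `T` lies in every `quotient (a j)` with j in `J`, so each such `a j` multiplies `T` into
        -- `A` and belongs to `S₀`.
        ∣J∣≤dimS₀ : ∣ J ∣ ℕ.≤ dim S₀
        ∣J∣≤dimS₀ = independent⇒∣J∣≤dim a (IsBasis.independent a-basis) J S₀
          λ j j∈J → IsBasis.members a-basis j , λ t∈T → proj₂ (proj₂ t∈T j j∈J)

        -- One unit comes from the strictness of the violation, the other from adjoining 1 to `T`.
        2+dimB≤ : 2 ℕ.+ dim B ℕ.≤ dim S₀ ℕ.+ dim W₀
        2+dimB≤ = begin
          2 ℕ.+ dim B                  ≤⟨ s≤s violation ⟩
          ℕ.suc (dim T ℕ.+ ∣ J ∣)      ≤⟨ ℕ.+-monoʳ-≤ (dim W₀) ∣J∣≤dimS₀ ⟩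
          dim W₀ ℕ.+ dim S₀            ≡⟨ ℕ.+-comm (dim W₀) (dim S₀) ⟩
          dim S₀ ℕ.+ dim W₀            ∎
          where open ℕ.≤-Reasoning

        W₀⊆B⊞K : carrier W₀ ⊆ carrier B ⊞ K
        W₀⊆B⊞K (t , l , t∈T , (k , k∈K , l≈k1) , w≈t+l) =
          t , k , proj₁ t∈T , k∈K , trans w≈t+l (+-congˡ (trans l≈k1 (*-identityʳ k)))

        dimW₀≤ : dim W₀ ℕ.≤ ℕ.suc (dim B)
        dimW₀≤ = s≤s (dim-mono T B proj₁)

      abstract
        -- The surplus of two is used twice. Against `dim S` at most `dim B` it gives `W` dimension
        -- at least two; against `dim W` at most `dim B` plus one it makes `S` nonzero, as the
        -- descent to a minimal stable subspace requires.
        violation⇒stable : ∃[ W ] ∃[ S ] 1# ∈ₛ W × carrier W ⊆ carrier B ⊞ K × 2 ℕ.≤ dim W ×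
          Stable W S × 1 ℕ.≤ dim S × dim S ℕ.≤ dim B
        violation⇒stable =
          let (S , W , 1∈W , W≤W₀ , S≤A , stable , sum≤) = e-transform A S₀ W₀ (x∈adjoin T 1∉T) S₀W₀⊆A
              2+dimB≤′ = ℕ.≤-trans 2+dimB≤ sum≤
              dimS≤ = ℕ.≤-trans (dim-mono S A S≤A) (ℕ.≤-reflexive dimA≡dimB)
              dimW≤ = ℕ.≤-trans (dim-mono W W₀ W≤W₀) dimW₀≤
          in W , S , 1∈W , W₀⊆B⊞K ∘ W≤W₀ ,
            ℕ.+-cancelˡ-≤ (dim B) _ _ (ℕ.≤-trans (ℕ.≤-reflexive (ℕ.+-comm (dim B) 2))
              (ℕ.≤-trans 2+dimB≤′ (ℕ.+-monoˡ-≤ (dim W) dimS≤))) ,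
            stable ,
            ℕ.+-cancelʳ-≤ (ℕ.suc (dim B)) _ _ (ℕ.≤-trans 2+dimB≤′ (ℕ.+-monoʳ-≤ (dim S) dimW≤)) ,
            dimS≤

      atom-exists : ∃[ W ] IsSubspace W × W ⊆ carrier B ⊞ K ×
        (∃[ M ] IsSubfield L M × K ⊂ M × M ⊂ U × IsAtom W M)
      atom-exists =
        let (W , S , 1∈W , W⊆B⊞K , 2≤dimW , S-stable , 1≤dimS , dimS≤) = violation⇒stable
            open Atom W 1∈W
            (M , 1∈M , stable , minimal , dimM≤) = minimal-stable∋1 S (1≤dim⇒nonzero S 1≤dimS) S-stable
            -- If `M` were all of L, it would contain `B` with no larger dimension, hence equal `B`,
            -- and 1 would lie in `B`.
            M≢L = λ all → 1∉B (dim-equal B M (λ _ → all _) (ℕ.≤-trans dimM≤ dimS≤) 1∈M)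
        in carrier W , isSubspace W , W⊆B⊞K , carrier M ,
          minimal⇒subfield M 1∈M stable minimal ,
          ((λ k∈K → FinSubspace.resp M (*-identityʳ _) (FinSubspace.·-closed M k∈K 1∈M)) ,
           λ M⊆K → W⊈K W 2≤dimW (λ w∈W → M⊆K (FinSubspace.resp M (*-identityˡ _) (stable 1∈M w∈W)))) ,
          ((λ _ → tt) , (λ U⊆M → M≢L (λ x → U⊆M tt))) ,
          minimal⇒atom M 1∈M stable minimal M≢L
        where
        1∉0 : 1# ∉ₛ zeroSpace
        1∉0 (_ , _ , 1≈0) = 1≉0 1≈0
        -- `K` is the line through 1, of dimension one over itself.
        W⊈K : ∀ W → 2 ℕ.≤ dim W → ¬ carrier W ⊆ K
        W⊈K W 2≤dimW W⊆K = ℕ.<⇒≱ 2≤dimW (dim-mono W (adjoin zeroSpace 1∉0)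
          λ {w} w∈W → ⊞-upperʳ (isSubspace zeroSpace) (w , W⊆K w∈W , sym (*-identityʳ w)))

theorem1p9 : ∀ {c ℓ} → ExcludedMiddle (suc (c ⊔ ℓ)) →
    (L : Field c ℓ) (K : Subset L) → IsSubfield L K →
    let open Field L using (1#)
        open Extension L K in
    (n : ℕ) (A : Subset L) → IsSubspace A → HasDimension A n →
    (B : Subset L) → IsSubspace B → HasDimension B n →
    1# ∉ B → ¬ Matched n A B →
    ∃[ W ] IsSubspace W × W ⊆ B ⊞ K ×
      (∃[ M ] IsSubfield L M × K ⊂ M × M ⊂ U × IsAtom W M)
theorem1p9 em L K K-subfield n A A-sub A-dim B B-sub B-dim 1∉B unmatched =
  let (a , a-basis , J , violation) = unmatched⇒violation unmatched
  in atom-exists 1∉B a-basis J violation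
  where
  open LinearAlgebra em L K K-subfield
  A′ B′ : FinSubspace
  A′ = record { isSubspace = A-sub ; hasDimension = A-dim }
  B′ = record { isSubspace = B-sub ; hasDimension = B-dim }
  open Unmatched A′ B′ ≡.refl
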